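{- Let $\mathcal{H}$ be a family of graphs. There is a constant $C=C(\mathcal{H})$ such that $$\#\{v\in V(G):\alpha(N(v))\ge 2\}\le C$$ for every connected $\mathcal{H}$-free graph $G$ if and only if $$\mathcal{H}\le \{K_n^*,\ P_n,\ K_{1,n}^*,\ K_{2,n},\ E_2+K_n,\ K_1+nP_3,\ CK_n\}$$ for some positive integer $n$.
   Context: All graphs are finite, undirected and simple. For graphs $H_1,H_2$, write $H_1\le H_2$ if $H_1$ is (isomorphic to) an induced subgraph of $H_2$. A graph $G$ is $\mathcal{H}$-free if there is no $H\in\mathcal{H}$ with $H\le G$. For families of graphs $\mathcal{H}_1,\mathcal{H}_2$, write $\mathcal{H}_1\le\mathcal{H}_2$ if for every $H_2\in\mathcal{H}_2$ there is $H_1\in\mathcal{H}_1$ with $H_1\le H_2$. $N(v)$ is the set of vertices of $G$ adjacent to $v$, and for $S\subset V(G)$, $\alpha(S)$ is the independence number of the induced subgraph $G[S]$. $K_n$ is the complete graph and $E_n$ the edgeless graph on $n$ vertices, $P_n$ the path on $n$ vertices, $K_{s,t}$ the complete bipartite graph. $G_1+G_2$ denotes the join of $G_1$ and $G_2$: the graph with vertex set $V(G_1)\sqcup V(G_2)$ whose edges are those of $G_1$, those of $G_2$, and all pairs $\{x,y\}$ with $x\in V(G_1)$, $y\in V(G_2)$. $nG$ denotes the disjoint union of $n$ copies of $G$ (in $G_1+nG_2$ this is formed before the join). $K_{1,n}^*$ is obtained from the star $K_{1,n}$ by attaching one pendant vertex to each of its $n$ leaves. $K_n^*$ is obtained from $K_n$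 by attaching one pendant vertex to every vertex of $K_n$. $CK_n$ is obtained from two disjoint copies of $K_n$ by adding a perfect matching between them. -}

module Defs where

open import Data.Bool.Base using (true; false)
open import Data.Empty using (⊥)
open import Data.Fin.Base using (Fin; zero; suc; toℕ; _↑ʳ_)
open import Data.Fin.Properties using (+↔⊎; *↔×; all?) renaming (_≟_ to _≟ᶠ_)
open import Data.Fin.Subset using (Subset; inside; outside; ∣_∣) renaming (_∈_ to _∈ₛ_)
open import Data.Fin.Subset.Properties using (_∈?_)
open import Data.List.Base as List using (List; []; _∷_; _++_)
open import Data.List.Extrema.Nat using (max)
open import Data.List.Membership.Propositional using (_∈_)
open import Data.Nat.Base as ℕ using (ℕ; zero; suc)
import Data.Nat.Properties as ℕₚ
open import Data.Product.Base using (∃-syntax; _×_; _,_)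
open import Data.Sum.Base using (_⊎_; inj₁; inj₂; swap)
open import Data.Unit.Base using (⊤; tt)
open import Data.Vec.Base as Vec using ([]; _∷_)
open import Function.Base using (_∘_; id; _on_)
open import Function.Bundles using (_↔_; _⇔_; Inverse)
open import Function.Definitions using (Injective)
open import Level using (Level; 0ℓ) renaming (suc to lsuc; _⊔_ to _⊔ˡ_)
open import Relation.Binary.Construct.Closure.ReflexiveTransitive using (Star)
open import Relation.Binary.Core using (Rel)
open import Relation.Binary.Definitions using (Decidable; Symmetric)
open import Relation.Binary.PropositionalEquality using (_≡_; _≢_; refl; sym)
open import Relation.Nullary.Decidable using (yes; no; does; ¬?; _×-dec_; _⊎-dec_; _→-dec_)
open import Relation.Nullary.Negation using (¬_)
import Relation.Unary as Unary
open Unary using (Pred)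

private
  variable
    ℓ ℓ₁ ℓ₂ : Level

-- Finite simple graphs, with vertex set normalised to Fin order.  The graph
-- with no vertices is allowed.
record Graph : Set₁ where
  field
    order   : ℕ
    Adj     : Rel (Fin order) 0ℓ
    adj?    : Decidable Adj
    adj-sym : Symmetric Adj
    irrefl  : ∀ {v} → ¬ Adj v v

  V : Set
  V = Fin order

open Graph using (order; V)

record _≤ᵢ_ (H G : Graph) : Set where
  field
    embed     : V H → V G
    injective : Injective _≡_ _≡_ embed
    adj⇔adj   : ∀ u v → Graph.Adj H u v ⇔ Graph.Adj G (embed u) (embed v)

Free : Pred Graph ℓ → Pred Graph (lsuc 0ℓ ⊔ˡ ℓ)
Free ℋ G = ¬ (∃[ H ] (ℋ H × H ≤ᵢ G))

_≼_ : Pred Graph ℓ₁ → Pred Graph ℓ₂ → Set (lsuc 0ℓ ⊔ˡ ℓ₁ ⊔ˡ ℓ₂)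
ℋ₁ ≼ ℋ₂ = ∀ H₂ → ℋ₂ H₂ → ∃[ H₁ ] (ℋ₁ H₁ × H₁ ≤ᵢ H₂)

Connected : Graph → Set
Connected G = ∀ u v → Star (Graph.Adj G) u v

⟪_⟫ : ∀ {n} {Q : Pred (Fin n) 0ℓ} → Unary.Decidable Q → Subset n
⟪ Q? ⟫ = Vec.tabulate (does ∘ Q?)

-- The increasing enumeration of the elements of a subset.
element : ∀ {n} (S : Subset n) → Fin ∣ S ∣ → Fin n
element (true  ∷ S) zero    = zero
element (true  ∷ S) (suc i) = suc (element S i)
element (false ∷ S) i       = suc (element S i)

_[_] : (G : Graph) → Subset (order G) → Graph
G [ S ] = record
  { order   = ∣ S ∣
  ; Adj     = Adj on element S
  ; adj?    = λ u v → adj? (element S u) (element S v)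
  ; adj-sym = adj-sym
  ; irrefl  = irrefl
  }
  where open Graph G

subsets : ∀ n → List (Subset n)
subsets zero    = [] ∷ []
subsets (suc n) = List.map (inside ∷_) (subsets n) ++ List.map (outside ∷_) (subsets n)

Independent : (G : Graph) → Pred (Subset (order G)) 0ℓ
Independent G T = ∀ u v → u ∈ₛ T → v ∈ₛ T → ¬ Graph.Adj G u v

independent? : (G : Graph) → Unary.Decidable (Independent G)
independent? G T = all? λ u → all? λ v →
  (u ∈? T) →-dec (v ∈? T) →-dec ¬? (Graph.adj? G u v)

α : Graph → ℕ
α G = max 0 (List.map ∣_∣ (List.filter (independent? G) (subsets (order G))))

N : (G : Graph) → V G → Subset (order G)
N G v = ⟪ Graph.adj? G v ⟫

#[α∘N≥2] : Graph → ℕ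
#[α∘N≥2] G = ∣ ⟪ (λ v → 2 ℕₚ.≤? α (G [ N G v ])) ⟫ ∣

fromFinite : ∀ {n} {A : Set} → Fin n ↔ A →
             (R : Rel A 0ℓ) → Decidable R → Symmetric R → (∀ {x} → ¬ R x x) → Graph
fromFinite {n} A-finite R R? R-sym R-irrefl = record
  { order   = n
  ; Adj     = R on to
  ; adj?    = λ u v → R? (to u) (to v)
  ; adj-sym = R-sym
  ; irrefl  = R-irrefl
  }
  where open Inverse A-finite using (to)

K : ℕ → Graph
K n = record
  { order   = n
  ; Adj     = _≢_
  ; adj?    = λ u v → ¬? (u ≟ᶠ v)
  ; adj-sym = λ u≢v → u≢v ∘ sym
  ; irrefl  = λ v≢v → v≢v refl
  }

E : ℕ → Graph
E n = record
  { order   = n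
  ; Adj     = λ _ _ → ⊥
  ; adj?    = λ _ _ → no id
  ; adj-sym = id
  ; irrefl  = id
  }

P : ℕ → Graph
P n = record
  { order   = n
  ; Adj     = λ u v → suc (toℕ u) ≡ toℕ v ⊎ suc (toℕ v) ≡ toℕ u
  ; adj?    = λ u v → (suc (toℕ u) ℕₚ.≟ toℕ v) ⊎-dec (suc (toℕ v) ℕₚ.≟ toℕ u)
  ; adj-sym = swap
  ; irrefl  = λ { (inj₁ eq) → ℕₚ.1+n≢n eq ; (inj₂ eq) → ℕₚ.1+n≢n eq }
  }

module _ (G₁ G₂ : Graph) where
  private
    module G₁ = Graph G₁
    module G₂ = Graph G₂

  JoinAdj : Rel (V G₁ ⊎ V G₂) 0ℓ
  JoinAdj (inj₁ u) (inj₁ v) = G₁.Adj u v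
  JoinAdj (inj₁ u) (inj₂ v) = ⊤
  JoinAdj (inj₂ u) (inj₁ v) = ⊤
  JoinAdj (inj₂ u) (inj₂ v) = G₂.Adj u v

  joinAdj? : Decidable JoinAdj
  joinAdj? (inj₁ u) (inj₁ v) = G₁.adj? u v
  joinAdj? (inj₁ u) (inj₂ v) = yes tt
  joinAdj? (inj₂ u) (inj₁ v) = yes tt
  joinAdj? (inj₂ u) (inj₂ v) = G₂.adj? u v

  joinAdj-sym : Symmetric JoinAdj
  joinAdj-sym {inj₁ u} {inj₁ v} = G₁.adj-sym
  joinAdj-sym {inj₁ u} {inj₂ v} = id
  joinAdj-sym {inj₂ u} {inj₁ v} = id
  joinAdj-sym {inj₂ u} {inj₂ v} = G₂.adj-sym

  joinAdj-irrefl : ∀ {x} → ¬ JoinAdj x x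
  joinAdj-irrefl {inj₁ u} = G₁.irrefl
  joinAdj-irrefl {inj₂ u} = G₂.irrefl

-- The join, not the disjoint union.
infixl 6 _+ᴳ_

_+ᴳ_ : Graph → Graph → Graph
G₁ +ᴳ G₂ = fromFinite +↔⊎ (JoinAdj G₁ G₂)
  (joinAdj? G₁ G₂)
  (λ {x} {y} → joinAdj-sym G₁ G₂ {x} {y})
  (λ {x} → joinAdj-irrefl G₁ G₂ {x})

K[_,_] : ℕ → ℕ → Graph
K[ s , t ] = E s +ᴳ E t

-- The disjoint union of n copies of G.
infixr 7 _·_

_·_ : ℕ → Graph → Graph
n · G = fromFinite (*↔× {n} {order G})
  (λ (i , u) (j , v) → i ≡ j × Adj u v)
  (λ (i , u) (j , v) → (i ≟ᶠ j) ×-dec adj? u v)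
  (λ (i≡j , uv) → sym i≡j , adj-sym uv)
  (λ (_ , vv) → irrefl vv)
  where open Graph G

module _ (G : Graph) {k : ℕ} (f : Fin k → V G) where
  open Graph G using (Adj; adj?; adj-sym; irrefl)

  PendantAdj : Rel (V G ⊎ Fin k) 0ℓ
  PendantAdj (inj₁ u) (inj₁ v) = Adj u v
  PendantAdj (inj₁ u) (inj₂ j) = u ≡ f j
  PendantAdj (inj₂ i) (inj₁ v) = v ≡ f i
  PendantAdj (inj₂ i) (inj₂ j) = ⊥

  pendantAdj? : Decidable PendantAdj
  pendantAdj? (inj₁ u) (inj₁ v) = adj? u v
  pendantAdj? (inj₁ u) (inj₂ j) = u ≟ᶠ f j
  pendantAdj? (inj₂ i) (inj₁ v) = v ≟ᶠ f i
  pendantAdj? (inj₂ i) (inj₂ j) = no id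

  pendantAdj-sym : Symmetric PendantAdj
  pendantAdj-sym {inj₁ u} {inj₁ v} = adj-sym
  pendantAdj-sym {inj₁ u} {inj₂ j} = id
  pendantAdj-sym {inj₂ i} {inj₁ v} = id
  pendantAdj-sym {inj₂ i} {inj₂ j} = id

  pendantAdj-irrefl : ∀ {x} → ¬ PendantAdj x x
  pendantAdj-irrefl {inj₁ u} = irrefl
  pendantAdj-irrefl {inj₂ i} = id

  -- Adds k new vertices of degree one, the i-th being attached to f i.
  attachPendants : Graph
  attachPendants = fromFinite +↔⊎ PendantAdj pendantAdj?
    (λ {x} {y} → pendantAdj-sym {x} {y})
    (λ {x} → pendantAdj-irrefl {x})

-- In K[ 1 , n ] the centre is the vertex 0 and the leaves are the 1 ↑ʳ i.
K₁* : ℕ → Graph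
K₁* n = attachPendants K[ 1 , n ] {n} (1 ↑ʳ_)

K* : ℕ → Graph
K* n = attachPendants (K n) id

module _ (n : ℕ) where

  CKAdj : Rel (Fin n ⊎ Fin n) 0ℓ
  CKAdj (inj₁ i) (inj₁ j) = i ≢ j
  CKAdj (inj₁ i) (inj₂ j) = i ≡ j
  CKAdj (inj₂ i) (inj₁ j) = i ≡ j
  CKAdj (inj₂ i) (inj₂ j) = i ≢ j

  ckAdj? : Decidable CKAdj
  ckAdj? (inj₁ i) (inj₁ j) = ¬? (i ≟ᶠ j)
  ckAdj? (inj₁ i) (inj₂ j) = i ≟ᶠ j
  ckAdj? (inj₂ i) (inj₁ j) = i ≟ᶠ j
  ckAdj? (inj₂ i) (inj₂ j) = ¬? (i ≟ᶠ j)

  ckAdj-sym : Symmetric CKAdj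
  ckAdj-sym {inj₁ i} {inj₁ j} = λ i≢j → i≢j ∘ sym
  ckAdj-sym {inj₁ i} {inj₂ j} = sym
  ckAdj-sym {inj₂ i} {inj₁ j} = sym
  ckAdj-sym {inj₂ i} {inj₂ j} = λ i≢j → i≢j ∘ sym

  ckAdj-irrefl : ∀ {x} → ¬ CKAdj x x
  ckAdj-irrefl {inj₁ i} = λ i≢i → i≢i refl
  ckAdj-irrefl {inj₂ i} = λ i≢i → i≢i refl

  CK : Graph
  CK = fromFinite +↔⊎ CKAdj ckAdj?
    (λ {x} {y} → ckAdj-sym {x} {y})
    (λ {x} → ckAdj-irrefl {x})

unavoidable : ℕ → Pred Graph (lsuc 0ℓ)
unavoidable n G = G ∈ (K* n ∷ P n ∷ K₁* n ∷ K[ 2 , n ] ∷ E 2 +ᴳ K n ∷ K 1 +ᴳ n · P 3 ∷ CK n ∷ [])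

{-# OPTIONS --safe #-}
module Submission where

-- The vertices counted are the non-simplicial ones.  Each of the seven graphs
-- is connected with at least n − 2 of them, so a bound C forces a member of ℋ
-- into each of the seven for n = C + 3.
--
-- Conversely, the inner vertices of a shortest path are non-simplicial, so
-- shortest paths between non-simplicial vertices run through such vertices, and
-- they are induced, hence short when P n is excluded.  A large number of
-- non-simplicial vertices thus yields a vertex x with many non-simplicial
-- neighbours y, and by Ramsey a clique or an independent set of these.
-- Choose non-adjacent neighbours a, b of every y.  In a clique, regular
-- adjacencies between the a and the y give E₂ + K n, CK n or K* n, unless some
-- a and b are joined to all later y, which is again E₂ + K n.  In an independent
-- set, either many y have a neighbour outside the closed neighbourhood of x,
-- which gives K[ 2 , n ], K* n or K₁* n, or the a and b lie in the neighbourhood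
-- of x, which gives K₁ + n P₃ once no a or b is shared by several y.

open import Axiom.ExcludedMiddle using (ExcludedMiddle)
open import Data.Bool.Base using (true; false)
open import Data.Fin.Base as Fin using (Fin; zero; suc; toℕ; fromℕ<; inject₁; inject≤; _↑ʳ_; remQuot)
open import Data.Fin.Induction using (<-weakInduction)
import Data.Fin.Properties as Fin
open import Data.Fin.Properties using (toℕ-inject≤; toℕ<n; toℕ-fromℕ<; injective⇒≤; any?)
open import Data.Fin.Subset using (Subset; inside; ∣_∣; ⁅_⁆; _∪_) renaming (_∈_ to _∈ₛ_)
open import Data.Fin.Subset.Properties using (x∈⁅x⁆; x∈⁅y⁆⇒x≡y; x∈p∪q⁺; x∈p∪q⁻)
open import Data.List.Base as List using (List; []; _∷_; _++_; length; filter; lookup; allFin; concatMap)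
open import Data.List.Extrema.Nat using (v≤max⁺; argmax-sel)
open import Data.List.Membership.Propositional using (_∈_; lose)
open import Data.List.Membership.Propositional.Properties using (∈-lookup; ∈-map⁺; ∈-map⁻; ∈-filter⁺; ∈-filter⁻; ∈-++⁺ˡ; ∈-++⁺ʳ; ∈-concatMap⁺; ∈-tabulate⁺)
open import Data.List.Properties using (length-++; length-tabulate)
open import Data.List.Relation.Unary.All as All using (All; []; _∷_)
import Data.List.Relation.Unary.All.Properties as All
open import Data.List.Relation.Unary.AllPairs as AllPairs using (AllPairs; []; _∷_)
import Data.List.Relation.Unary.AllPairs.Properties as AllPairs
open import Data.List.Relation.Unary.Any as Any using (here; there)
open import Data.List.Relation.Unary.Any.Properties using (lookup-index)
open import Data.Nat.Base using (ℕ; zero; suc; _+_; _*_; _∸_; _^_; _≤_; _<_; z≤n; s≤s; z<s; s<s)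
open import Data.Nat.Properties using (≤-trans; ≤-refl; ≤-reflexive; ≤-pred; n≤1+n; n<1+n; m≤n⇒m≤1+n; m≤n+m; +-comm; +-suc; +-mono-<; +-monoˡ-<; +-monoʳ-≤; +-mono-≤; *-suc; *-monoʳ-≤; <⇒≱; <⇒≢; ≰⇒>; ≮⇒≥; <⇒≤; ≤∧≢⇒<; _≤?_; m∸n+n≡m)
open import Data.Product.Base using (∃; ∃-syntax; _×_; _,_; proj₁; proj₂)
open import Data.Sum.Base as Sum using (_⊎_; inj₁; inj₂; [_,_]′)
open import Data.Sum.Properties using (inj₁-injective; inj₂-injective)
open import Data.Unit.Base using (⊤; tt)
open import Data.Vec.Base using ([]; _∷_; here; there)
open import Data.Vec.Properties using (lookup∘tabulate; []=⇒lookup; lookup⇒[]=)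
open import Function.Base using (_∘_; id; flip; _on_)
open import Function.Bundles using (_⇔_; mk⇔; Equivalence; Inverse; Injection; _↔_)
open import Function.Definitions using (Injective)
open import Function.Properties.Inverse using (↔⇒↣)
open import Level using (0ℓ; _⊔_) renaming (suc to lsuc)
open import Relation.Binary.Construct.Closure.ReflexiveTransitive as Star using (Star; ε; _◅_; _◅◅_)
open import Relation.Binary.Construct.Intersection using (_∩_)
open import Relation.Binary.Core using (Rel)
open import Relation.Binary.Definitions using (Decidable; tri<; tri≈; tri>)
open import Relation.Binary.PropositionalEquality using (_≡_; _≢_; refl; sym; trans; cong; subst; subst₂)
open import Relation.Nullary.Decidable using (yes; no; does; ¬?; _×-dec_; dec-true)
open import Relation.Nullary.Negation using (¬_; contradiction)
open import Relation.Unary using (Pred)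
import Relation.Unary as Unary
open import Defs

-- Ramsey's theorem for lists

ramseyBound : ℕ → ℕ → ℕ
ramseyBound zero    _       = 0
ramseyBound (suc m) zero    = 0
ramseyBound (suc m) (suc l) = suc (ramseyBound m (suc l) + ramseyBound (suc m) l)

+-pigeonhole : ∀ m {n o p} → m + n ≤ o + p → m ≤ o ⊎ n ≤ p
+-pigeonhole m {n} {o} {p} le with m ≤? o | n ≤? p
... | yes m≤o | _       = inj₁ m≤o
... | no _    | yes n≤p = inj₂ n≤p
... | no m≰o  | no n≰p  = contradiction le (<⇒≱ (+-mono-< (≰⇒> m≰o) (≰⇒> n≰p)))

-- Ramsey yields relations from earlier to later entries, while the embeddings ask for all distinct
-- indices; this is the bridge.
by-order : ∀ {m} {R : Rel (Fin m) 0ℓ} → (∀ {i j} → i Fin.< j → R i j) → (∀ {i j} → i Fin.< j → R j i) →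
      ∀ {i j} → i ≢ j → R i j
by-order R< R> {i} {j} i≢j with Fin.<-cmp i j
... | tri< i<j _ _ = R< i<j
... | tri≈ _ i≡j _ = contradiction i≡j i≢j
... | tri> _ _ j<i = R> j<i

module _ {A : Set} where

  -- `Q` runs from each earlier entry to each later one and may be asymmetric, as in
  -- `Adj (a p) (y q)`; so mixed adjacencies, too, can be made regular by Ramsey. The length is only
  -- bounded below, so that no list has to be cut.
  Many : ℕ → Rel A 0ℓ → Set
  Many m Q = ∃[ xs ] (m ≤ length xs × AllPairs Q xs)

  many-map : ∀ {m} {Q R : Rel A 0ℓ} → (∀ {p q} → Q p q → R p q) → Many m Q → Many m R
  many-map Q⇒R (xs , m≤ , qs) = xs , m≤ , AllPairs.map Q⇒R qs

  -- Reversing the list turns `Q` into its converse. This serves when a vertex is joined to earlier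
  -- entries, or when the last entries have a special task.
  many-flip : ∀ {m} {Q : Rel A 0ℓ} → Many m Q → Many m (flip Q)
  many-flip {m} {Q} (xs , m≤ , qs) with go {P = λ _ → ⊤} (All.universal-U xs) qs
    where
    -- As in `ramsey-list`, the free predicate `P` carries the relations of the head through the
    -- recursive call.
    go : ∀ {P : Pred A 0ℓ} {xs} → All P xs → AllPairs Q xs →
         ∃[ ys ] (length ys ≡ length xs × All P ys × AllPairs (flip Q) ys)
    go [] [] = [] , refl , [] , []
    go {xs = x ∷ xs} (px ∷ pxs) (qx ∷ qxs) with go (All.zip (pxs , qx)) qxs
    ... | ys , eq , pys , qys =
      ys ++ x ∷ [] , trans (length-++ ys) (trans (+-comm _ 1) (cong suc eq)) ,
      All.++⁺ (All.map proj₁ pys) (px ∷ []) ,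
      AllPairs.++⁺ qys ([] ∷ []) (All.map (λ pq → proj₂ pq ∷ []) pys)
  ... | ys , eq , _ , qys = ys , ≤-trans m≤ (≤-reflexive (sym eq)) , qys

  lookup-AllPairs : ∀ {Q : Rel A 0ℓ} {xs} → AllPairs Q xs →
                    ∀ i j → i Fin.< j → Q (lookup xs i) (lookup xs j)
  lookup-AllPairs (qx ∷ _)  zero    (suc j) _         = All.lookup qx (∈-lookup j)
  lookup-AllPairs (_ ∷ qxs) (suc i) (suc j) (s<s i<j) = lookup-AllPairs qxs i j i<j

  sequence : ∀ {m Q} → Many m Q → ∃[ f ] (∀ (i j : Fin m) → i Fin.< j → Q (f i) (f j))
  sequence (xs , m≤ , qs) =
    (λ i → lookup xs (inject≤ i m≤)) ,
    λ i j i<j → lookup-AllPairs qs _ _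
      (≤-trans (s≤s (≤-reflexive (toℕ-inject≤ i m≤)))
        (≤-trans i<j (≤-reflexive (sym (toℕ-inject≤ j m≤)))))

  distinct-sequence : ∀ {m Q} {S : Rel A 0ℓ} →
    (∀ {p q} → Q p q → S p q) → (∀ {p q} → Q p q → S q p) → Many m Q →
    ∃[ f ] (∀ {i j : Fin m} → i ≢ j → S (f i) (f j))
  distinct-sequence Q⇒S Q⇒Sᵒ many with f , seq ← sequence many =
    f , by-order (λ i<j → Q⇒S (seq _ _ i<j)) (λ i<j → Q⇒Sᵒ (seq _ _ i<j))

  length-filter-complement : ∀ {P : Pred A 0ℓ} (P? : Unary.Decidable P) xs →
    length xs ≡ length (filter P? xs) + length (filter (¬? ∘ P?) xs)
  length-filter-complement P? []       = refl
  length-filter-complement P? (x ∷ xs) with P? x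
  ... | yes _ = cong suc (length-filter-complement P? xs)
  ... | no _  = trans (cong suc (length-filter-complement P? xs)) (sym (+-suc _ _))

  -- The predicate P is threaded through the induction so that the head of the
  -- list stays related to the sublist found in the tail.
  ramsey-list : ∀ {R Q : Rel A 0ℓ} → Decidable R → ∀ {P : Pred A 0ℓ} m l xs →
    ramseyBound m l ≤ length xs → All P xs → AllPairs Q xs →
    (∃[ ys ] (m ≤ length ys × All P ys × AllPairs (Q ∩ R) ys)) ⊎
    (∃[ ys ] (l ≤ length ys × All P ys × AllPairs (Q ∩ (λ p q → ¬ R p q)) ys))
  ramsey-list R? zero    l       xs len pxs qxs = inj₁ ([] , z≤n , [] , [])
  ramsey-list R? (suc m) zero    xs len pxs qxs = inj₂ ([] , z≤n , [] , [])
  ramsey-list R? (suc m) (suc l) (x ∷ xs) (s≤s len) (px ∷ pxs) (qx ∷ qxs)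
    with +-pigeonhole (ramseyBound m (suc l))
           (≤-trans len (≤-reflexive (length-filter-complement (R? x) xs)))
  ... | inj₁ len₁
      with ramsey-list R? m (suc l) (filter (R? x) xs) len₁
             (All.zip (All.filter⁺ (R? x) pxs ,
               All.zip (All.filter⁺ (R? x) qx , All.all-filter (R? x) xs)))
             (AllPairs.filter⁺ (R? x) qxs)
  ...   | inj₁ (ys , m≤ , pys , rys) =
            inj₁ (x ∷ ys , s≤s m≤ , px ∷ All.map proj₁ pys , All.map proj₂ pys ∷ rys)
  ...   | inj₂ (ys , l≤ , pys , rys) = inj₂ (ys , l≤ , All.map proj₁ pys , rys)
  ramsey-list R? (suc m) (suc l) (x ∷ xs) (s≤s len) (px ∷ pxs) (qx ∷ qxs)
      | inj₂ len₂
      with ramsey-list R? (suc m) l (filter (¬? ∘ R? x) xs) len₂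
             (All.zip (All.filter⁺ (¬? ∘ R? x) pxs ,
               All.zip (All.filter⁺ (¬? ∘ R? x) qx , All.all-filter (¬? ∘ R? x) xs)))
             (AllPairs.filter⁺ (¬? ∘ R? x) qxs)
  ...   | inj₁ (ys , m≤ , pys , rys) = inj₁ (ys , m≤ , All.map proj₁ pys , rys)
  ...   | inj₂ (ys , l≤ , pys , rys) =
            inj₂ (x ∷ ys , s≤s l≤ , px ∷ All.map proj₁ pys , All.map proj₂ pys ∷ rys)

  -- A pair is coloured by `R` read in list order, so `R` need not be symmetric. Sublists keep `Q`,
  -- hence repeated applications accumulate what is known.
  ramsey : ∀ {R Q : Rel A 0ℓ} → Decidable R → ∀ m l → Many (ramseyBound m l) Q →
    Many m (Q ∩ R) ⊎ Many l (Q ∩ (λ p q → ¬ R p q))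
  ramsey R? m l (xs , len , qs) =
    Sum.map drop drop (ramsey-list R? m l xs len (All.universal-U xs) qs)
    where
    drop : ∀ {k S} → ∃[ ys ] (k ≤ length ys × All (λ _ → ⊤) ys × AllPairs S ys) → Many k S
    drop (ys , len , _ , rs) = ys , len , rs

-- The entries are paired with their proofs of `B` or `C`, so that vertices chosen in these proofs
-- become functions of the entry.
many-split : ∀ {A : Set} {B C : Pred A 0ℓ} {Q : Rel A 0ℓ} → (∀ p → B p ⊎ C p) → ∀ m l →
  Many (m + l) Q →
  Many {A = ∃ B} m (Q on proj₁) ⊎ Many {A = ∃ C} l (Q on proj₁)
many-split {A} {B} {C} {Q} d m l (xs , len , qs) with go {P = λ _ → ⊤} (All.universal-U xs) qs
  where
  go : ∀ {P : Pred A 0ℓ} {xs} → All P xs → AllPairs Q xs →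
       ∃[ bs ] ∃[ cs ] (length xs ≡ length {A = ∃ B} bs + length {A = ∃ C} cs ×
         (All (P ∘ proj₁) bs × AllPairs (Q on proj₁) bs) ×
         (All (P ∘ proj₁) cs × AllPairs (Q on proj₁) cs))
  go [] [] = [] , [] , refl , ([] , []) , ([] , [])
  go {xs = x ∷ _} (px ∷ pxs) (qx ∷ qxs) with d x | go (All.zip (pxs , qx)) qxs
  ... | inj₁ b | bs , cs , eq , (pbs , qbs) , (pcs , qcs) =
    (x , b) ∷ bs , cs , cong suc eq ,
    (px ∷ All.map proj₁ pbs , All.map proj₂ pbs ∷ qbs) , (All.map proj₁ pcs , qcs)
  ... | inj₂ c | bs , cs , eq , (pbs , qbs) , (pcs , qcs) =
    bs , (x , c) ∷ cs , trans (cong suc eq) (sym (+-suc _ _)) ,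
    (All.map proj₁ pbs , qbs) , (px ∷ All.map proj₁ pcs , All.map proj₂ pcs ∷ qcs)
... | bs , cs , eq , (_ , qbs) , (_ , qcs) with +-pigeonhole m (≤-trans len (≤-reflexive eq))
...   | inj₁ m≤ = inj₁ (bs , m≤ , qbs)
...   | inj₂ l≤ = inj₂ (cs , l≤ , qcs)

many-tabulate : ∀ {m} {Q : Rel (Fin m) 0ℓ} → (∀ {i j} → i Fin.< j → Q i j) → Many m Q
many-tabulate {m} <⇒Q = allFin m , ≤-reflexive (sym (length-tabulate id)) , AllPairs.tabulate⁺-< <⇒Q

-- Subsets and the independence number

element-∈ : ∀ {n} (S : Subset n) i → element S i ∈ₛ S
element-∈ (true  ∷ S) zero    = here
element-∈ (true  ∷ S) (suc i) = there (element-∈ S i)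
element-∈ (false ∷ S) i       = there (element-∈ S i)

element-injective : ∀ {n} (S : Subset n) → Injective _≡_ _≡_ (element S)
element-injective (true  ∷ S) {zero}  {zero}  eq = refl
element-injective (true  ∷ S) {suc i} {suc j} eq = cong suc (element-injective S (Fin.suc-injective eq))
element-injective (false ∷ S) eq = element-injective S (Fin.suc-injective eq)

element⁻¹ : ∀ {n} {S : Subset n} {x} → x ∈ₛ S → ∃[ i ] element S i ≡ x
element⁻¹ {S = true ∷ S} here = zero , refl
element⁻¹ {S = true ∷ S} (there x∈S) with i , eq ← element⁻¹ x∈S = suc i , cong suc eq
element⁻¹ {S = false ∷ S} (there x∈S) with i , eq ← element⁻¹ x∈S = i , cong suc eq

injective⇒≤∣∣ : ∀ {k n} (S : Subset n) {f : Fin k → Fin n} → Injective _≡_ _≡_ f →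
                (∀ i → f i ∈ₛ S) → k ≤ ∣ S ∣
injective⇒≤∣∣ S {f} f-inj f∈S = injective⇒≤ {f = λ i → proj₁ (element⁻¹ (f∈S i))} λ {i} {j} eq →
  f-inj (trans (sym (proj₂ (element⁻¹ (f∈S i))))
    (trans (cong (element S) eq) (proj₂ (element⁻¹ (f∈S j)))))

module _ {n} {Q : Pred (Fin n) 0ℓ} (Q? : Unary.Decidable Q) where

  ∈⟪⟫⁺ : ∀ {x} → Q x → x ∈ₛ ⟪ Q? ⟫
  ∈⟪⟫⁺ {x} qx = lookup⇒[]= x _ (trans (lookup∘tabulate (does ∘ Q?) x) (dec-true (Q? x) qx))

  ∈⟪⟫⁻ : ∀ {x} → x ∈ₛ ⟪ Q? ⟫ → Q x
  ∈⟪⟫⁻ {x} x∈ with Q? x | trans (sym (lookup∘tabulate (does ∘ Q?) x)) ([]=⇒lookup x∈)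
  ... | yes qx | _ = qx

  element-⟪⟫ : ∀ i → Q (element ⟪ Q? ⟫ i)
  element-⟪⟫ i = ∈⟪⟫⁻ (element-∈ ⟪ Q? ⟫ i)

∈-subsets : ∀ {n} (S : Subset n) → S ∈ subsets n
∈-subsets []          = here refl
∈-subsets (true  ∷ S) = ∈-++⁺ˡ (∈-map⁺ _ (∈-subsets S))
∈-subsets (false ∷ S) = ∈-++⁺ʳ (List.map (inside ∷_) (subsets _)) (∈-map⁺ _ (∈-subsets S))

-- The pair formed by `u` and `v` is one of the independent subsets over which the maximum is taken.
2≤α⁺ : ∀ G {u v} → u ≢ v → ¬ Graph.Adj G u v → 2 ≤ α G
2≤α⁺ G {u} {v} u≢v u≁v = v≤max⁺ 0 _ (inj₂ (lose (∈-map⁺ ∣_∣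
    (∈-filter⁺ (independent? G) (∈-subsets pair) independent)) 2≤∣pair∣))
  where
  open Graph G
  pair = ⁅ u ⁆ ∪ ⁅ v ⁆
  ends : Fin 2 → V
  ends zero    = u
  ends (suc _) = v
  ends-injective : Injective _≡_ _≡_ ends
  ends-injective {zero}     {zero}     _  = refl
  ends-injective {zero}     {suc zero} eq = contradiction eq u≢v
  ends-injective {suc zero} {zero}     eq = contradiction (sym eq) u≢v
  ends-injective {suc zero} {suc zero} _  = refl
  2≤∣pair∣ : 2 ≤ ∣ pair ∣
  2≤∣pair∣ = injective⇒≤∣∣ pair {ends} ends-injective λ where
    zero       → x∈p∪q⁺ (inj₁ (x∈⁅x⁆ u))
    (suc zero) → x∈p∪q⁺ {p = ⁅ u ⁆} (inj₂ (x∈⁅x⁆ v))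
  ∈pair⁻ : ∀ {x} → x ∈ₛ pair → x ≡ u ⊎ x ≡ v
  ∈pair⁻ = Sum.map (x∈⁅y⁆⇒x≡y u) (x∈⁅y⁆⇒x≡y v) ∘ x∈p∪q⁻ ⁅ u ⁆ ⁅ v ⁆
  independent : Independent G pair
  independent x y x∈ y∈ with ∈pair⁻ x∈ | ∈pair⁻ y∈
  ... | inj₁ refl | inj₁ refl = irrefl
  ... | inj₁ refl | inj₂ refl = u≁v
  ... | inj₂ refl | inj₁ refl = u≁v ∘ adj-sym
  ... | inj₂ refl | inj₂ refl = irrefl

2≤α⁻ : ∀ G → 2 ≤ α G → ∃[ u ] ∃[ v ] (u ≢ v × ¬ Graph.Adj G u v)
2≤α⁻ G 2≤α with argmax-sel id 0 (List.map ∣_∣ (filter (independent? G) (subsets (Graph.order G))))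
-- The maximum is either its default value 0, excluded here, or the size of a listed subset.
... | inj₁ α≡0 = contradiction (≤-trans 2≤α (≤-reflexive α≡0)) λ ()
... | inj₂ α∈ with ∈-map⁻ ∣_∣ α∈
...   | T , T∈ , α≡∣T∣ = element T i , element T j , i≢j ∘ element-injective T ,
        independent _ _ (element-∈ T i) (element-∈ T j)
  where
  2≤∣T∣ = ≤-trans 2≤α (≤-reflexive α≡∣T∣)
  independent = proj₂ (∈-filter⁻ (independent? G) {xs = subsets (Graph.order G)} T∈)
  i = fromℕ< (≤-trans (s≤s z≤n) 2≤∣T∣)
  j = fromℕ< 2≤∣T∣
  i≢j : i ≢ j
  i≢j i≡j with () ← trans (sym (toℕ-fromℕ< _)) (trans (cong toℕ i≡j) (toℕ-fromℕ< 2≤∣T∣))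

-- The two neighbours are kept as witnesses in place of an independence number, for the Ramsey
-- arguments use them as the `a` and `b` of each vertex.
NonSimplicial : (G : Graph) → Pred (Graph.V G) 0ℓ
NonSimplicial G v = ∃[ a ] ∃[ b ] (Adj v a × Adj v b × a ≢ b × ¬ Adj a b)
  where open Graph G

module _ (G : Graph) where
  open Graph G

  2≤α∘N : Pred V 0ℓ
  2≤α∘N v = 2 ≤ α (G [ N G v ])

  2≤α∘N? : Unary.Decidable 2≤α∘N
  2≤α∘N? v = 2 ≤? α (G [ N G v ])

  nonSimplicial⇒2≤α∘N : ∀ {v} → NonSimplicial G v → 2≤α∘N v
  nonSimplicial⇒2≤α∘N {v} (a , b , va , vb , a≢b , a≁b)
    with i , refl ← element⁻¹ (∈⟪⟫⁺ (adj? v) va) | j , refl ← element⁻¹ (∈⟪⟫⁺ (adj? v) vb) =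
    2≤α⁺ (G [ N G v ]) (a≢b ∘ cong (element (N G v))) a≁b

  2≤α∘N⇒nonSimplicial : ∀ {v} → 2≤α∘N v → NonSimplicial G v
  2≤α∘N⇒nonSimplicial {v} 2≤α with i , j , i≢j , i≁j ← 2≤α⁻ (G [ N G v ]) 2≤α =
    element (N G v) i , element (N G v) j , element-⟪⟫ (adj? v) i , element-⟪⟫ (adj? v) j ,
    i≢j ∘ element-injective (N G v) , i≁j

-- Induced embeddings of the seven graphs

open Graph using (V)
open _≤ᵢ_ using (embed)

-- Chosen vertices of `G` may coincide, and a missing edge does not exclude this; an induced copy
-- needs both facts.
Apart : (G : Graph) → Rel (V G) 0ℓ
Apart G u v = u ≢ v × ¬ Graph.Adj G u v

apart-sym : ∀ G {u v} → Apart G u v → Apart G v u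
apart-sym G (u≢v , u≁v) = u≢v ∘ sym , u≁v ∘ Graph.adj-sym G

-- Injectivity follows: adjacent vertices have adjacent images, which differ by irreflexivity, and
-- all other distinct vertices have `Apart` images.
≤ᵢ-intro : ∀ {H G} (e : V H → V G) →
  (∀ {u v} → Graph.Adj H u v → Graph.Adj G (e u) (e v)) →
  (∀ {u v} → u ≢ v → ¬ Graph.Adj H u v → Apart G (e u) (e v)) → H ≤ᵢ G
≤ᵢ-intro {H} {G} e adj apart = record
  { embed     = e
  ; injective = injective
  ; adj⇔adj   = λ u v → mk⇔ adj (reflects u v)
  }
  where
  injective : Injective _≡_ _≡_ e
  injective {u} {v} eq with u Fin.≟ v | Graph.adj? H u v
  ... | yes u≡v | _      = u≡v
  ... | no _    | yes uv = contradiction (subst (Graph.Adj G (e u)) (sym eq) (adj uv)) (Graph.irrefl G)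
  ... | no u≢v  | no u≁v = contradiction eq (proj₁ (apart u≢v u≁v))
  reflects : ∀ u v → Graph.Adj G (e u) (e v) → Graph.Adj H u v
  reflects u v euv with u Fin.≟ v | Graph.adj? H u v
  ... | _        | yes uv = uv
  ... | yes refl | no _   = contradiction euv (Graph.irrefl G)
  ... | no u≢v   | no u≁v = contradiction euv (proj₂ (apart u≢v u≁v))

≤ᵢ⇒apart : ∀ {H G} (h : H ≤ᵢ G) {u v} → u ≢ v → ¬ Graph.Adj H u v → Apart G (embed h u) (embed h v)
≤ᵢ⇒apart h u≢v u≁v = u≢v ∘ _≤ᵢ_.injective h , u≁v ∘ Equivalence.from (_≤ᵢ_.adj⇔adj h _ _)

≤ᵢ⇒adj : ∀ {H G} (h : H ≤ᵢ G) {u v} → Graph.Adj H u v → Graph.Adj G (embed h u) (embed h v)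
≤ᵢ⇒adj h = Equivalence.to (_≤ᵢ_.adj⇔adj h _ _)

-- For a graph built by `fromFinite` the equation is `refl`, and the embedding can be given by cases
-- on the sum or product `A` instead of on `Fin`.
relabel-≤ᵢ : ∀ {H G} {A : Set} (A-finite : Fin (Graph.order H) ↔ A) (R : Rel A 0ℓ) →
  Graph.Adj H ≡ (R on Inverse.to A-finite) → (e : A → V G) →
  (∀ x y → R x y → Graph.Adj G (e x) (e y)) →
  (∀ x y → x ≢ y → ¬ R x y → Apart G (e x) (e y)) → H ≤ᵢ G
relabel-≤ᵢ A-finite R refl e adj apart =
  ≤ᵢ-intro (e ∘ Inverse.to A-finite) (adj _ _)
    (λ u≢v → apart _ _ (u≢v ∘ Injection.injective (↔⇒↣ A-finite)))

module _ {G : Graph} where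
  open Graph G using (Adj; adj-sym; irrefl)

  K-≤ᵢ : ∀ {k} {f : Fin k → V G} → (∀ {i j} → i ≢ j → Adj (f i) (f j)) → K k ≤ᵢ G
  K-≤ᵢ {f = f} clique = ≤ᵢ-intro f clique (λ i≢j i≡j → contradiction i≢j i≡j)

  E-≤ᵢ : ∀ {k} {f : Fin k → V G} → (∀ {i j} → i ≢ j → Apart G (f i) (f j)) → E k ≤ᵢ G
  E-≤ᵢ {f = f} apart = ≤ᵢ-intro f (λ ()) (λ i≢j _ → apart i≢j)

  K₁-≤ᵢ : V G → K 1 ≤ᵢ G
  K₁-≤ᵢ x = K-≤ᵢ {f = λ _ → x} λ { {zero} {zero} 0≢0 → contradiction refl 0≢0 }

  E₁-≤ᵢ : V G → E 1 ≤ᵢ G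
  E₁-≤ᵢ x = E-≤ᵢ {f = λ _ → x} λ { {zero} {zero} 0≢0 → contradiction refl 0≢0 }

  E₂-≤ᵢ : ∀ {u v} → Apart G u v → E 2 ≤ᵢ G
  E₂-≤ᵢ {u} {v} uv = E-≤ᵢ {f = e} apart
    where
    e : Fin 2 → V G
    e zero    = u
    e (suc _) = v
    apart : ∀ {i j} → i ≢ j → Apart G (e i) (e j)
    apart {zero}     {zero}     0≢0 = contradiction refl 0≢0
    apart {zero}     {suc zero} _   = uv
    apart {suc zero} {zero}     _   = apart-sym G uv
    apart {suc zero} {suc zero} 1≢1 = contradiction refl 1≢1

  P₃-≤ᵢ : ∀ {a y b} → Adj y a → Adj y b → Apart G a b → P 3 ≤ᵢ G
  P₃-≤ᵢ {a} {y} {b} ya yb ab = ≤ᵢ-intro e adj apart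
    where
    e : Fin 3 → V G
    e zero          = a
    e (suc zero)    = y
    e (suc (suc _)) = b
    adj : ∀ {u v : Fin 3} → Graph.Adj (P 3) u v → Adj (e u) (e v)
    adj {zero}         {zero}         (inj₁ ())
    adj {zero}         {zero}         (inj₂ ())
    adj {zero}         {suc zero}     _ = adj-sym ya
    adj {zero}         {suc (suc zero)} (inj₁ ())
    adj {zero}         {suc (suc zero)} (inj₂ ())
    adj {suc zero}     {zero}         _ = ya
    adj {suc zero}     {suc zero}     (inj₁ ())
    adj {suc zero}     {suc zero}     (inj₂ ())
    adj {suc zero}     {suc (suc zero)} _ = yb
    adj {suc (suc zero)} {zero}       (inj₁ ())
    adj {suc (suc zero)} {zero}       (inj₂ ())
    adj {suc (suc zero)} {suc zero}   _ = adj-sym yb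
    adj {suc (suc zero)} {suc (suc zero)} (inj₁ ())
    adj {suc (suc zero)} {suc (suc zero)} (inj₂ ())
    apart : ∀ {u v : Fin 3} → u ≢ v → ¬ Graph.Adj (P 3) u v → Apart G (e u) (e v)
    apart {zero}           {zero}           u≢v _   = contradiction refl u≢v
    apart {zero}           {suc zero}       _   u≁v = contradiction (inj₁ refl) u≁v
    apart {zero}           {suc (suc zero)} _   _   = ab
    apart {suc zero}       {zero}           _   u≁v = contradiction (inj₂ refl) u≁v
    apart {suc zero}       {suc zero}       u≢v _   = contradiction refl u≢v
    apart {suc zero}       {suc (suc zero)} _   u≁v = contradiction (inj₁ refl) u≁v
    apart {suc (suc zero)} {zero}           _   _   = apart-sym G ab
    apart {suc (suc zero)} {suc zero}       _   u≁v = contradiction (inj₂ refl) u≁v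
    apart {suc (suc zero)} {suc (suc zero)} u≢v _   = contradiction refl u≢v

  join-≤ᵢ : ∀ {G₁ G₂} (h₁ : G₁ ≤ᵢ G) (h₂ : G₂ ≤ᵢ G) →
    (∀ u v → Adj (embed h₁ u) (embed h₂ v)) → (G₁ +ᴳ G₂) ≤ᵢ G
  join-≤ᵢ {G₁} {G₂} h₁ h₂ complete = relabel-≤ᵢ Fin.+↔⊎ (JoinAdj G₁ G₂) refl e adj apart
    where
    e = [ embed h₁ , embed h₂ ]′
    adj : ∀ x y → JoinAdj G₁ G₂ x y → Adj (e x) (e y)
    adj (inj₁ u) (inj₁ v) uv = ≤ᵢ⇒adj h₁ uv
    adj (inj₁ u) (inj₂ v) _  = complete u v
    adj (inj₂ u) (inj₁ v) _  = adj-sym (complete v u)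
    adj (inj₂ u) (inj₂ v) uv = ≤ᵢ⇒adj h₂ uv
    apart : ∀ x y → x ≢ y → ¬ JoinAdj G₁ G₂ x y → Apart G (e x) (e y)
    apart (inj₁ u) (inj₁ v) x≢y x≁y = ≤ᵢ⇒apart h₁ (x≢y ∘ cong inj₁) x≁y
    apart (inj₁ u) (inj₂ v) _   x≁y = contradiction tt x≁y
    apart (inj₂ u) (inj₁ v) _   x≁y = contradiction tt x≁y
    apart (inj₂ u) (inj₂ v) x≢y x≁y = ≤ᵢ⇒apart h₂ (x≢y ∘ cong inj₂) x≁y

  copies-≤ᵢ : ∀ {k H} (h : Fin k → H ≤ᵢ G) →
    (∀ {i j} u v → i ≢ j → Apart G (embed (h i) u) (embed (h j) v)) → (k · H) ≤ᵢ G
  copies-≤ᵢ {k} {H} h disjoint = relabel-≤ᵢ (Fin.*↔× {k} {Graph.order H}) CopiesAdj refl e adj apart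
    where
    CopiesAdj : Rel (Fin k × V H) 0ℓ
    CopiesAdj (i , u) (j , v) = i ≡ j × Graph.Adj H u v
    e : Fin k × V H → V G
    e (i , u) = embed (h i) u
    adj : ∀ x y → CopiesAdj x y → Adj (e x) (e y)
    adj (i , u) (j , v) (refl , uv) = ≤ᵢ⇒adj (h i) uv
    apart : ∀ x y → x ≢ y → ¬ CopiesAdj x y → Apart G (e x) (e y)
    apart (i , u) (j , v) x≢y x≁y with i Fin.≟ j
    ... | yes refl = ≤ᵢ⇒apart (h i) (x≢y ∘ cong (i ,_)) (x≁y ∘ (refl ,_))
    ... | no i≢j   = disjoint u v i≢j

  pendants-≤ᵢ : ∀ {H k} {f : Fin k → V H} (h : H ≤ᵢ G) (p : Fin k → V G) →
    (∀ j → Adj (embed h (f j)) (p j)) →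
    (∀ {u j} → u ≢ f j → Apart G (embed h u) (p j)) →
    (∀ {i j} → i ≢ j → Apart G (p i) (p j)) → attachPendants H f ≤ᵢ G
  pendants-≤ᵢ {H} {f = f} h p attached others pendants =
    relabel-≤ᵢ Fin.+↔⊎ (PendantAdj H f) refl e adj apart
    where
    e = [ embed h , p ]′
    adj : ∀ x y → PendantAdj H f x y → Adj (e x) (e y)
    adj (inj₁ u) (inj₁ v) uv   = ≤ᵢ⇒adj h uv
    adj (inj₁ u) (inj₂ j) refl = attached j
    adj (inj₂ i) (inj₁ v) refl = adj-sym (attached i)
    apart : ∀ x y → x ≢ y → ¬ PendantAdj H f x y → Apart G (e x) (e y)
    apart (inj₁ u) (inj₁ v) x≢y x≁y = ≤ᵢ⇒apart h (x≢y ∘ cong inj₁) x≁y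
    apart (inj₁ u) (inj₂ j) _   x≁y = others x≁y
    apart (inj₂ i) (inj₁ v) _   x≁y = apart-sym G (others x≁y)
    apart (inj₂ i) (inj₂ j) x≢y _   = pendants (x≢y ∘ cong inj₂)

  CK-≤ᵢ : ∀ {k} {f g : Fin k → V G} →
    (∀ {i j} → i ≢ j → Adj (f i) (f j)) → (∀ {i j} → i ≢ j → Adj (g i) (g j)) →
    (∀ i → Adj (f i) (g i)) → (∀ {i j} → i ≢ j → Apart G (f i) (g j)) → CK k ≤ᵢ G
  CK-≤ᵢ {k} {f} {g} ff gg fg f≁g =
    relabel-≤ᵢ Fin.+↔⊎ (CKAdj k) refl e adj apart
    where
    e = [ f , g ]′
    adj : ∀ x y → CKAdj k x y → Adj (e x) (e y)
    adj (inj₁ i) (inj₁ j) i≢j  = ff i≢j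
    adj (inj₁ i) (inj₂ j) refl = fg i
    adj (inj₂ i) (inj₁ j) refl = adj-sym (fg i)
    adj (inj₂ i) (inj₂ j) i≢j  = gg i≢j
    apart : ∀ x y → x ≢ y → ¬ CKAdj k x y → Apart G (e x) (e y)
    apart (inj₁ i) (inj₁ j) x≢y ¬i≢j = contradiction (x≢y ∘ cong inj₁) ¬i≢j
    apart (inj₁ i) (inj₂ j) _   i≢j  = f≁g i≢j
    apart (inj₂ i) (inj₁ j) _   i≢j  = apart-sym G (f≁g (i≢j ∘ sym))
    apart (inj₂ i) (inj₂ j) x≢y ¬i≢j = contradiction (x≢y ∘ cong inj₂) ¬i≢j

-- Ramsey arguments around a vertex

module Bounds (n : ℕ) where

  -- The bounds nest in the order in which Ramsey is applied. Here `m` serves the adjacencies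
  -- between `a` and `y` in either direction, and `n` a clique of the `a`, which becomes `K* n`.
  separateBound : ℕ → ℕ → ℕ
  separateBound m l = ramseyBound m (ramseyBound m (ramseyBound n l))

  spikeBound : ℕ
  spikeBound = separateBound (1 + n) n

  sharedBound : ℕ
  sharedBound = ramseyBound (2 + n) (ramseyBound (1 + spikeBound) (2 + n))

  fanBound : ℕ
  fanBound = separateBound sharedBound
    (separateBound sharedBound (ramseyBound (2 + n) (ramseyBound (2 + n) n)))

  -- The constants added to `n` pay for entries with a special task: three for `E 2 +ᴳ K n`, and the
  -- spare index of `matching`.
  attachBound : ℕ → ℕ
  attachBound l = ramseyBound l (ramseyBound (3 + n) (ramseyBound (1 + n) (1 + n)))

  cliqueBound : ℕ
  cliqueBound = attachBound (attachBound (1 + n))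

  hubBound : ℕ
  hubBound = ramseyBound cliqueBound (spikeBound + fanBound)

module Forcing (G : Graph) (n : ℕ) where
  open Bounds n
  open Graph G using (Adj; adj?; adj-sym)

  Found : Set₁
  Found = ∃[ H ] (unavoidable n H × H ≤ᵢ G)

  K*-found : {f p : Fin n → V G} → (∀ {i j} → i ≢ j → Adj (f i) (f j)) → (∀ i → Adj (f i) (p i)) →
    (∀ {i j} → i ≢ j → Apart G (f i) (p j)) → (∀ {i j} → i ≢ j → Apart G (p i) (p j)) → Found
  K*-found {p = p} ff fp f≁p pp = _ , here refl , pendants-≤ᵢ (K-≤ᵢ ff) p fp f≁p pp

  K₁*-found : {x : V G} {f p : Fin n → V G} → (∀ i → Adj x (f i)) → (∀ i → Adj (f i) (p i)) →
    (∀ i → Apart G x (p i)) → (∀ {i j} → i ≢ j → Apart G (f i) (f j)) →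
    (∀ {i j} → i ≢ j → Apart G (f i) (p j)) → (∀ {i j} → i ≢ j → Apart G (p i) (p j)) → Found
  K₁*-found {x} {f} {p} xf fp xp ff f≁p pp =
    _ , there (there (here refl)) , pendants-≤ᵢ star p fp others pp
    where
    star = join-≤ᵢ (E₁-≤ᵢ x) (E-≤ᵢ ff) λ _ → xf
    others : ∀ {u j} → u ≢ 1 ↑ʳ j → Apart G (embed star u) (p j)
    others {zero}  {j} _   = xp j
    others {suc i} {j} u≢j = f≁p (u≢j ∘ cong suc)

  K₂-found : ∀ {u v} {f : Fin n → V G} → Apart G u v → (∀ i → Adj u (f i)) → (∀ i → Adj v (f i)) →
    (∀ {i j} → i ≢ j → Apart G (f i) (f j)) → Found
  K₂-found uv uf vf ff = _ , there (there (there (here refl))) ,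
    join-≤ᵢ (E₂-≤ᵢ uv) (E-≤ᵢ ff) λ { zero → uf ; (suc zero) → vf }

  E₂K-found : ∀ {u v} {f : Fin n → V G} → Apart G u v → (∀ i → Adj u (f i)) → (∀ i → Adj v (f i)) →
    (∀ {i j} → i ≢ j → Adj (f i) (f j)) → Found
  E₂K-found uv uf vf ff = _ , there (there (there (there (here refl)))) ,
    join-≤ᵢ (E₂-≤ᵢ uv) (K-≤ᵢ ff) λ { zero → uf ; (suc zero) → vf }

  K₁P₃-found : ∀ {x} {a y b : Fin n → V G} →
    (∀ i → Adj x (a i)) → (∀ i → Adj x (y i)) → (∀ i → Adj x (b i)) →
    (∀ i → Adj (y i) (a i)) → (∀ i → Adj (y i) (b i)) → (∀ i → Apart G (a i) (b i)) →
    (∀ {i j} → i ≢ j → Apart G (a i) (a j)) → (∀ {i j} → i ≢ j → Apart G (y i) (y j)) →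
    (∀ {i j} → i ≢ j → Apart G (b i) (b j)) → (∀ {i j} → i ≢ j → Apart G (a i) (y j)) →
    (∀ {i j} → i ≢ j → Apart G (b i) (y j)) → (∀ {i j} → i ≢ j → Apart G (a i) (b j)) → Found
  K₁P₃-found {x} xa xy xb ya yb ab aa yy bb a≁y b≁y a≁b =
    _ , there (there (there (there (there (here refl))))) ,
    join-≤ᵢ (K₁-≤ᵢ x) (copies-≤ᵢ path disjoint)
      λ _ v → dominated (proj₁ (remQuot 3 v)) (proj₂ (remQuot {n} 3 v))
    where
    path : Fin n → P 3 ≤ᵢ G
    path i = P₃-≤ᵢ (ya i) (yb i) (ab i)
    dominated : ∀ i u → Adj x (embed (path i) u)
    dominated i zero          = xa i
    dominated i (suc zero)    = xy i
    dominated i (suc (suc _)) = xb i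
    disjoint : ∀ {i j} u v → i ≢ j → Apart G (embed (path i) u) (embed (path j) v)
    disjoint zero          zero          i≢j = aa i≢j
    disjoint zero          (suc zero)    i≢j = a≁y i≢j
    disjoint zero          (suc (suc _)) i≢j = a≁b i≢j
    disjoint (suc zero)    zero          i≢j = apart-sym G (a≁y (i≢j ∘ sym))
    disjoint (suc zero)    (suc zero)    i≢j = yy i≢j
    disjoint (suc zero)    (suc (suc _)) i≢j = apart-sym G (b≁y (i≢j ∘ sym))
    disjoint (suc (suc _)) zero          i≢j = apart-sym G (a≁b (i≢j ∘ sym))
    disjoint (suc (suc _)) (suc zero)    i≢j = b≁y i≢j
    disjoint (suc (suc _)) (suc (suc _)) i≢j = bb i≢j

  CK-found : {f g : Fin n → V G} →
    (∀ {i j} → i ≢ j → Adj (f i) (f j)) → (∀ {i j} → i ≢ j → Adj (g i) (g j)) →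
    (∀ i → Adj (f i) (g i)) → (∀ {i j} → i ≢ j → Apart G (f i) (g j)) → Found
  CK-found ff gg fg f≁g =
    _ , there (there (there (there (there (there (here refl)))))) , CK-≤ᵢ ff gg fg f≁g

  -- `a` is adjacent to `u` and `v` is not, so they differ.
  pendant-apart : ∀ {u a v} → Adj u a → Apart G u v → ¬ Adj a v → Apart G a v
  pendant-apart ua uv a≁v = (λ a≡v → proj₂ uv (subst (Adj _) a≡v ua)) , a≁v

  module _ {A : Set} (y a : A → V G) where

    Shared : Rel A 0ℓ
    Shared p q = Apart G (y p) (y q) × Adj (a p) (y q)

    Detached : Rel A 0ℓ
    Detached p q = Apart G (a p) (y q) × Apart G (a q) (y p) × Apart G (a p) (a q)

    -- Ramsey is applied to the pairs `a p`, `y q`, then `a q`, `y p`, then `a p`, `a q`. An edge in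
    -- the first or second step means that each `a` serves many `y`; if both are excluded, a clique
    -- of the `a` completes `K* n`.
    separate : (∀ p → Adj (y p) (a p)) → ∀ {Q} → (∀ {p q} → Q p q → Apart G (y p) (y q)) →
      ∀ m l → Many (separateBound m l) Q → Many m Shared ⊎ Found ⊎ Many l (Q ∩ Detached)
    separate ya {Q} Q⇒yy m l many with ramsey (λ p q → adj? (a p) (y q)) m _ many
    ... | inj₁ shared = inj₁ (many-map (λ (q , ay) → Q⇒yy q , ay) shared)
    ... | inj₂ many₁ with ramsey (λ p q → adj? (a q) (y p)) m _ many₁
    -- Here `a q` is joined to the earlier `y p`; reversal gives the form of `Shared`.
    ...   | inj₁ shared = inj₁ (many-flip {Q = flip Shared}
              (many-map (λ ((q , _) , ay) → apart-sym G (Q⇒yy q) , ay) shared))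
    ...   | inj₂ many₂ with ramsey (λ p q → adj? (a p) (a q)) n l many₂
    -- The `a` form the clique, and each `y` is the pendant of its own `a`.
    ...     | inj₁ cliques = inj₂ (inj₁ (K*-found
                (λ i≢j → proj₁ (proj₂ (seq i≢j))) (λ i → adj-sym (ya (f i)))
                (λ i≢j → proj₂ (proj₂ (seq i≢j))) (λ i≢j → proj₁ (seq i≢j))))
              where
              S : Rel A 0ℓ
              S p q = Apart G (y p) (y q) × Adj (a p) (a q) × Apart G (a p) (y q)
              many-S : ∃[ f ] (∀ {i j : Fin n} → i ≢ j → S (f i) (f j))
              many-S = distinct-sequence {S = S}
                (λ (((q , ¬ay) , _) , aa) → Q⇒yy q , aa , pendant-apart (ya _) (Q⇒yy q) ¬ay)
                (λ (((q , _) , ¬ay) , aa) → let yy = apart-sym G (Q⇒yy q) in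
                  yy , adj-sym aa , pendant-apart (ya _) yy ¬ay)
                cliques
              f = proj₁ many-S
              seq : ∀ {i j} → i ≢ j → S (f i) (f j)
              seq = proj₂ many-S
    ...     | inj₂ many₃ = inj₂ (inj₂ (many-map
                (λ (((q , ¬ay) , ¬ay′) , ¬aa) →
                  let ay  = pendant-apart (ya _) (Q⇒yy q) ¬ay
                      ay′ = pendant-apart (ya _) (apart-sym G (Q⇒yy q)) ¬ay′ in
                  q , ay , ay′ ,
                  -- `a q` is adjacent to `y q` and `a p` is not.
                  (λ a≡a → ¬ay (subst (λ v → Adj v _) (sym a≡a) (adj-sym (ya _)))) , ¬aa)
                many₃))

  -- If one `z` serves many `y`, then it and `x` are the two centres of `K[ 2 , n ]`. If all are
  -- detached, the `y` and `z` are the leaves and pendants of `K₁* n` with centre `x`.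
  spikes-found : ∀ {A : Set} {x} {y z : A → V G} →
    (∀ p → Adj x (y p)) → (∀ p → Apart G x (z p)) → (∀ p → Adj (y p) (z p)) →
    Many spikeBound (Apart G on y) → Found
  spikes-found {A} {x} {y} {z} xy xz yz many with separate y z yz id (1 + n) n many
  ... | inj₁ shared with f , seq ← sequence shared =
        K₂-found (xz (f zero)) (xy ∘ f ∘ suc) (λ i → proj₂ (seq zero (suc i) z<s))
          (by-order (λ i<j → proj₁ (seq _ _ (s<s i<j))) (λ i<j → apart-sym G (proj₁ (seq _ _ (s<s i<j)))))
  ... | inj₂ (inj₁ found) = found
  ... | inj₂ (inj₂ detached) with f , seq ← distinct-sequence
          {S = λ p q → Apart G (y p) (y q) × Apart G (z q) (y p) × Apart G (z p) (z q)}
          (λ (yy , zy , zy′ , zz) → yy , zy′ , zz)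
          (λ (yy , zy , zy′ , zz) → apart-sym G yy , zy , apart-sym G zz) detached =
        K₁*-found (xy ∘ f) (yz ∘ f) (xz ∘ f) (λ i≢j → proj₁ (seq i≢j))
          (λ i≢j → apart-sym G (proj₁ (proj₂ (seq i≢j)))) (λ i≢j → proj₂ (proj₂ (seq i≢j)))

  -- Two `y` have the earlier `a` as common neighbours, and two `a` have the later `y`. The first
  -- helps when the `a` form a clique, the second when they are independent.
  shared-found : ∀ {A : Set} {y a b : A → V G} →
    (∀ p → Adj (y p) (b p)) → (∀ p → Apart G (a p) (b p)) → Many sharedBound (Shared y a) → Found
  shared-found {A} {y} {a} {b} yb ab many with ramsey (λ p q → adj? (a p) (a q)) (2 + n) _ many
  -- After reversal the first two `y` are joined to every `a` of larger index.
  ... | inj₁ cliques with f , seq ← sequence (many-flip cliques) =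
        E₂K-found (apart-sym G (proj₁ (proj₁ (seq zero (suc zero) z<s))))
          (λ i → adj-sym (proj₂ (proj₁ (seq zero (suc (suc i)) z<s))))
          (λ i → adj-sym (proj₂ (proj₁ (seq (suc zero) (suc (suc i)) (s<s z<s)))))
          (by-order (λ i<j → adj-sym (proj₂ (seq _ _ (s<s (s<s i<j)))))
                    (λ i<j → proj₂ (seq _ _ (s<s (s<s i<j)))))
  -- Pairwise non-adjacent `a` may still coincide, so equality is made regular as well.
  ... | inj₂ many₁ with ramsey (λ p q → a p Fin.≟ a q) (1 + spikeBound) (2 + n) many₁
  -- The common value of a takes the place of x, and the b p are the spikes.
  ...   | inj₁ constant with f , seq ← sequence constant =
          spikes-found {x = a (f zero)} {y ∘ f ∘ suc} {b ∘ f ∘ suc}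
            (λ i → proj₂ (proj₁ (proj₁ (seq zero (suc i) z<s))))
            (λ i → subst (λ v → Apart G v _) (sym (proj₂ (seq zero (suc i) z<s))) (ab _))
            (λ i → yb _)
            (many-tabulate λ i<j → proj₁ (proj₁ (proj₁ (seq _ _ (s<s i<j)))))
  ...   | inj₂ distinct with f , seq ← sequence distinct =
          K₂-found (proj₂ (seq zero (suc zero) z<s) , proj₂ (proj₁ (seq zero (suc zero) z<s)))
            (λ i → proj₂ (proj₁ (proj₁ (seq zero (suc (suc i)) z<s))))
            (λ i → proj₂ (proj₁ (proj₁ (seq (suc zero) (suc (suc i)) (s<s z<s)))))
            (by-order (λ i<j → yy (s<s (s<s i<j))) (λ i<j → apart-sym G (yy (s<s (s<s i<j)))))
          where
          yy : ∀ {i j} → i Fin.< j → Apart G (y (f i)) (y (f j))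
          yy i<j = proj₁ (proj₁ (proj₁ (seq _ _ i<j)))

  -- Once the `a` and the `b` are detached from foreign `y`, each of the two families is
  -- independent. Regular edges between them give `K[ 2 , n ]`; without such edges the paths `a`,
  -- `y`, `b` are disjoint copies of `P 3` below `x`.
  fan-found : ∀ {A : Set} {x} {y a b : A → V G} →
    (∀ p → Adj x (y p)) → (∀ p → Adj x (a p)) → (∀ p → Adj x (b p)) →
    (∀ p → Adj (y p) (a p)) → (∀ p → Adj (y p) (b p)) → (∀ p → Apart G (a p) (b p)) →
    Many fanBound (Apart G on y) → Found
  fan-found {A} {x} {y} {a} {b} xy xa xb ya yb ab many with separate y a ya id _ _ many
  ... | inj₁ shared       = shared-found yb ab shared
  ... | inj₂ (inj₁ found) = found
  ... | inj₂ (inj₂ many₁) with separate y b yb proj₁ _ _ many₁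
  ...   | inj₁ shared       = shared-found ya (λ p → apart-sym G (ab p)) shared
  ...   | inj₂ (inj₁ found) = found
  ...   | inj₂ (inj₂ many₂) with ramsey (λ p q → adj? (a p) (b q)) (2 + n) _ many₂
  -- The first two `a` are joined to all `b` from index 2 on; in the other direction below, `a` and
  -- `b` change places.
  ...     | inj₁ adjacent with f , seq ← sequence adjacent =
            K₂-found (aa (seq zero (suc zero) z<s))
              (λ i → proj₂ (seq zero (suc (suc i)) z<s))
              (λ i → proj₂ (seq (suc zero) (suc (suc i)) (s<s z<s)))
              (by-order (λ i<j → bb (seq _ _ (s<s (s<s i<j))))
                        (λ i<j → apart-sym G (bb (seq _ _ (s<s (s<s i<j))))))
            where
            aa : ∀ {p q} → ((((Apart G on y) ∩ Detached y a) ∩ Detached y b) ∩ λ p q → Adj (a p) (b q)) p q →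
                 Apart G (a p) (a q)
            aa (((_ , _ , _ , aa′) , _) , _) = aa′
            bb : ∀ {p q} → ((((Apart G on y) ∩ Detached y a) ∩ Detached y b) ∩ λ p q → Adj (a p) (b q)) p q →
                 Apart G (b p) (b q)
            bb ((_ , _ , _ , bb′) , _) = bb′
  ...     | inj₂ many₃ with ramsey (λ p q → adj? (a q) (b p)) (2 + n) n many₃
  ...       | inj₁ adjacent with f , seq ← sequence adjacent =
              K₂-found (bb (seq zero (suc zero) z<s))
                (λ i → adj-sym (proj₂ (seq zero (suc (suc i)) z<s)))
                (λ i → adj-sym (proj₂ (seq (suc zero) (suc (suc i)) (s<s z<s))))
                (by-order (λ i<j → aa (seq _ _ (s<s (s<s i<j))))
                          (λ i<j → apart-sym G (aa (seq _ _ (s<s (s<s i<j))))))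
              where
              R : Rel A 0ℓ
              R = ((((Apart G on y) ∩ Detached y a) ∩ Detached y b) ∩ λ p q → ¬ Adj (a p) (b q)) ∩
                  λ p q → Adj (a q) (b p)
              aa : ∀ {p q} → R p q → Apart G (a p) (a q)
              aa ((((_ , _ , _ , aa′) , _) , _) , _) = aa′
              bb : ∀ {p q} → R p q → Apart G (b p) (b q)
              bb (((_ , _ , _ , bb′) , _) , _) = bb′
  ...       | inj₂ many₄ with f , seq ← distinct-sequence
                {S = λ p q → Apart G (a p) (a q) × Apart G (y p) (y q) × Apart G (b p) (b q) ×
                             Apart G (a p) (y q) × Apart G (b p) (y q) × ¬ Adj (a p) (b q)}
                (λ ((((yy , ay , _ , aa) , by , _ , bb) , ¬ab) , _) → aa , yy , bb , ay , by , ¬ab)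
                (λ ((((yy , _ , ay , aa) , _ , by , bb) , _) , ¬ab) →
                  apart-sym G aa , apart-sym G yy , apart-sym G bb , ay , by , ¬ab)
                many₄ =
              K₁P₃-found (xa ∘ f) (xy ∘ f) (xb ∘ f) (ya ∘ f) (yb ∘ f) (ab ∘ f)
                (λ i≢j → let aa , _ = seq i≢j in aa)
                (λ i≢j → let _ , yy , _ = seq i≢j in yy)
                (λ i≢j → let _ , _ , bb , _ = seq i≢j in bb)
                (λ i≢j → let _ , _ , _ , ay , _ = seq i≢j in ay)
                (λ i≢j → let _ , _ , _ , _ , by , _ = seq i≢j in by)
                (λ i≢j → let _ , _ , _ , (_ , a≁y) , _ , a≁b = seq i≢j in
                  -- `b` is adjacent to its own `y`, which the foreign `a` is not.
                  (λ a≡b → a≁y (subst (λ v → Adj v _) (sym a≡b) (adj-sym (yb _)))) , a≁b)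

  -- The spare index 0 shows that no vertex of g occurs in f at another index.
  matching : ∀ {f g : Fin (1 + n) → V G} → (∀ {i j} → i ≢ j → Adj (f i) (f j)) →
    (∀ {i j} → i ≢ j → ¬ Adj (g i) (f j)) → ∀ {i j} → i ≢ j → Apart G (f (suc i)) (g (suc j))
  matching ff gf i≢j =
    (λ f≡g → gf {j = zero} (λ ()) (subst (λ v → Adj v _) f≡g (ff λ ()))) ,
    gf (i≢j ∘ sym ∘ Fin.suc-injective) ∘ adj-sym

  -- If the `a` are not joined to later `y`, edges to all earlier `y` give `E 2 +ᴳ K n`. With no
  -- foreign edges at all, the `y` and `a` form `CK n` or `K* n`, according to whether the `a` are a
  -- clique or independent.
  attach : ∀ {A : Set} {y a : A → V G} → (∀ p → Adj (y p) (a p)) →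
    ∀ {Q} → (∀ {p q} → Q p q → Adj (y p) (y q)) → ∀ l → Many (attachBound l) Q →
    Found ⊎ Many l (Q ∩ λ p q → Adj (a p) (y q))
  attach {A} {y} {a} ya {Q} Q⇒yy l many with ramsey (λ p q → adj? (a p) (y q)) l _ many
  ... | inj₁ shared = inj₂ shared
  ... | inj₂ many₁ with ramsey (λ p q → adj? (a q) (y p)) (3 + n) _ many₁
  -- y₀ and a₂ are the two non-adjacent vertices; y₁ only serves to show y₀ ≢ a₂.
  ...   | inj₁ half with f , seq ← sequence (many-flip half) =
          inj₁ (E₂K-found
            ((λ y≡a → a₂≁y₁ (subst (λ v → Adj v _) y≡a (adj-sym y₁y₀))) , a₂≁y₀ ∘ adj-sym)
            (λ i → adj-sym (Q⇒yy (proj₁ (proj₁ (seq zero (suc (suc (suc i))) z<s)))))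
            (λ i → proj₂ (seq (suc (suc zero)) (suc (suc (suc i))) (s<s (s<s z<s))))
            (by-order (λ i<j → adj-sym (yy (s<s (s<s (s<s i<j))))) (λ i<j → yy (s<s (s<s (s<s i<j))))))
          where
          yy : ∀ {i j} → i Fin.< j → Adj (y (f j)) (y (f i))
          yy i<j = Q⇒yy (proj₁ (proj₁ (seq _ _ i<j)))
          y₁y₀ = yy {zero} {suc zero} z<s
          a₂≁y₀ = proj₂ (proj₁ (seq zero (suc (suc zero)) z<s))
          a₂≁y₁ = proj₂ (proj₁ (seq (suc zero) (suc (suc zero)) (s<s z<s)))
  ...   | inj₂ many₂ with ramsey (λ p q → adj? (a p) (a q)) (1 + n) (1 + n) many₂
  ...     | inj₁ cliques with f , seq ← distinct-sequence
              {S = λ p q → Adj (y p) (y q) × ¬ Adj (a p) (y q) × Adj (a p) (a q)}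
              (λ (((q , a≁y) , _) , aa) → Q⇒yy q , a≁y , aa)
              (λ (((q , _) , a≁y) , aa) → adj-sym (Q⇒yy q) , a≁y , adj-sym aa) cliques =
            inj₁ (CK-found (λ i≢j → proj₁ (seq (i≢j ∘ Fin.suc-injective)))
              (λ i≢j → proj₂ (proj₂ (seq (i≢j ∘ Fin.suc-injective))))
              (ya ∘ f ∘ suc) (matching (λ i≢j → proj₁ (seq i≢j)) (λ i≢j → proj₁ (proj₂ (seq i≢j)))))
  ...     | inj₂ independents with f , seq ← distinct-sequence
              {S = λ p q → Adj (y p) (y q) × ¬ Adj (a p) (y q) × ¬ Adj (a p) (a q)}
              (λ (((q , a≁y) , _) , aa) → Q⇒yy q , a≁y , aa)
              (λ (((q , _) , a≁y) , aa) → adj-sym (Q⇒yy q) , a≁y , aa ∘ adj-sym) independents =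
            inj₁ (K*-found (λ i≢j → proj₁ (seq (i≢j ∘ Fin.suc-injective)))
              (ya ∘ f ∘ suc) (matching (λ i≢j → proj₁ (seq i≢j)) (λ i≢j → proj₁ (proj₂ (seq i≢j))))
              (λ i≢j → let _ , a≁y , a≁a = seq (i≢j ∘ Fin.suc-injective) in
                (λ a≡a → a≁y (subst (λ v → Adj v _) (sym a≡a) (adj-sym (ya _)))) , a≁a))

  -- If both rounds of `attach` leave a list, the `a` and `b` of its first entry are joined to all
  -- later `y`, which gives `E 2 +ᴳ K n`.
  cliques-found : ∀ {A : Set} {y a b : A → V G} →
    (∀ p → Adj (y p) (a p)) → (∀ p → Adj (y p) (b p)) → (∀ p → Apart G (a p) (b p)) →
    Many cliqueBound (Adj on y) → Found
  cliques-found ya yb ab many with attach ya id (attachBound (1 + n)) many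
  ... | inj₁ found = found
  ... | inj₂ many₁ with attach yb proj₁ (1 + n) many₁
  ...   | inj₁ found = found
  ...   | inj₂ many₂ with f , seq ← sequence many₂ =
          E₂K-found (ab (f zero)) (λ i → proj₂ (proj₁ (seq zero (suc i) z<s)))
            (λ i → proj₂ (seq zero (suc i) z<s))
            (by-order (λ i<j → proj₁ (proj₁ (seq _ _ (s<s i<j))))
                      (λ i<j → adj-sym (proj₁ (proj₁ (seq _ _ (s<s i<j))))))

  hub-found : ∀ {x} {y : Fin hubBound → V G} → Injective _≡_ _≡_ y → (∀ i → Adj x (y i)) →
    (∀ i → NonSimplicial G (y i)) → Found
  hub-found {x} {y} y-inj xy ns
    -- Starting from distinctness makes the independent outcome exactly `Apart G on y`.
    with ramsey {Q = _≢_ on y} (λ i j → adj? (y i) (y j)) cliqueBound (spikeBound + fanBound)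
           (many-tabulate λ i<j → Fin.<⇒≢ i<j ∘ y-inj)
  ... | inj₁ cliques =
        cliques-found (λ i → proj₁ (proj₂ (proj₂ (ns i)))) (λ i → proj₁ (proj₂ (proj₂ (proj₂ (ns i)))))
          (λ i → proj₂ (proj₂ (proj₂ (proj₂ (ns i))))) (many-map proj₂ cliques)
  ... | inj₂ independents = [ spikes , fans ]′ (many-split dichotomy spikeBound fanBound independents)
    where
    Spike Fan : Pred (Fin hubBound) 0ℓ
    Spike i = ∃[ z ] (Apart G x z × Adj (y i) z)
    Fan i   = ∃[ a ] ∃[ b ] (Adj x a × Adj x b × Adj (y i) a × Adj (y i) b × Apart G a b)
    dichotomy : ∀ i → Spike i ⊎ Fan i
    dichotomy i with a , b , ya , yb , a≢b , a≁b ← ns i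
      with x Fin.≟ a | x Fin.≟ b | adj? x a | adj? x b
    -- If one of the two neighbours is `x` itself, the other is a spike, being apart from it.
    ... | yes refl | _        | _      | _      = inj₁ (b , (a≢b , a≁b) , yb)
    ... | no _     | yes refl | _      | _      = inj₁ (a , apart-sym G (a≢b , a≁b) , ya)
    ... | no x≢a   | no _     | no x≁a | _      = inj₁ (a , (x≢a , x≁a) , ya)
    ... | no _     | no x≢b   | yes _  | no x≁b = inj₁ (b , (x≢b , x≁b) , yb)
    ... | no _     | no _     | yes xa | yes xb = inj₂ (a , b , xa , xb , ya , yb , a≢b , a≁b)
    spikes : Many {∃ Spike} spikeBound _ → Found
    spikes many = spikes-found {y = y ∘ proj₁} {z = proj₁ ∘ proj₂} (xy ∘ proj₁)
      (λ (_ , _ , xz , _) → xz) (λ (_ , _ , _ , yz) → yz) many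
    fans : Many {∃ Fan} fanBound _ → Found
    fans many = fan-found {y = y ∘ proj₁} {a = proj₁ ∘ proj₂} {b = proj₁ ∘ proj₂ ∘ proj₂} (xy ∘ proj₁)
      (λ (_ , _ , _ , xa , _) → xa) (λ (_ , _ , _ , _ , xb , _) → xb)
      (λ (_ , _ , _ , _ , _ , ya , _) → ya) (λ (_ , _ , _ , _ , _ , _ , yb , _) → yb)
      (λ (_ , _ , _ , _ , _ , _ , _ , ab) → ab) many

-- Shortest paths

least : ∀ {P : Pred ℕ 0ℓ} → Unary.Decidable P → ∀ k → P k → ∃[ m ] (P m × (∀ {j} → j < m → ¬ P j))
least P? k pk with P? 0
least P? k       pk | yes p₀ = 0 , p₀ , λ ()
least P? zero    pk | no ¬p₀ = contradiction pk ¬p₀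
least P? (suc k) pk | no ¬p₀ with m , pm , minimal ← least (P? ∘ suc) k pk =
  suc m , pm , λ { {zero} _ → ¬p₀ ; {suc j} (s<s j<m) → minimal j<m }

length-concatMap-≤ : ∀ {A B : Set} {f : A → List B} {c} → (∀ x → length (f x) ≤ c) →
  ∀ xs → length (concatMap f xs) ≤ c * length xs
length-concatMap-≤ f≤c [] = z≤n
length-concatMap-≤ {f = f} {c} f≤c (x ∷ xs) =
  ≤-trans (≤-reflexive (length-++ (f x)))
    (≤-trans (+-mono-≤ (f≤c x) (length-concatMap-≤ f≤c xs)) (≤-reflexive (sym (*-suc c _))))

injective⇒≤length : ∀ {A : Set} {m} {f : Fin m → A} {xs : List A} → Injective _≡_ _≡_ f →
  (∀ i → f i ∈ xs) → m ≤ length xs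
injective⇒≤length {f = f} {xs} f-inj f∈ = injective⇒≤ {f = Any.index ∘ f∈} λ {i} {j} eq →
  f-inj (trans (lookup-index (f∈ i)) (trans (cong (lookup xs) eq) (sym (lookup-index (f∈ j)))))

module Distance (G : Graph) (r : V G) where
  open Graph G using (Adj; adj?; adj-sym)

  Walk : ℕ → Pred (V G) 0ℓ
  Walk zero    v = r ≡ v
  Walk (suc k) v = ∃[ u ] (Walk k u × Adj u v)

  walk? : ∀ k → Unary.Decidable (Walk k)
  walk? zero    v = r Fin.≟ v
  walk? (suc k) v = any? λ u → walk? k u ×-dec adj? u v

  -- Distance is a relation, so that it makes sense without a proof that `v` can be reached.
  Dist : ℕ → Pred (V G) 0ℓ
  Dist k v = Walk k v × (∀ {j} → j < k → ¬ Walk j v)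

  star⇒walk : ∀ {k u v} → Walk k u → Star Adj u v → ∃[ l ] Walk l v
  star⇒walk walk ε         = _ , walk
  star⇒walk walk (uw ◅ wv) = star⇒walk (_ , walk , uw) wv

  dist : ∀ {v} → Star Adj r v → ∃[ k ] Dist k v
  dist {v} rv with k , walk ← star⇒walk {0} refl rv = least (λ j → walk? j v) k walk

  -- A shorter walk to `u` would extend by the edge to a shorter walk to `v`.
  predecessor : ∀ {k v} → Dist (suc k) v → ∃[ u ] (Dist k u × Adj u v)
  predecessor ((u , walk , uv) , minimal) =
    u , (walk , λ j<k walk′ → minimal (s<s j<k) (u , walk′ , uv)) , uv

  dist-step : ∀ {k l u v} → Dist k u → Dist l v → Adj u v → l ≤ suc k
  dist-step (walk , _) (_ , minimal) uv = ≮⇒≥ λ k<l → minimal k<l (_ , walk , uv)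

  dist-unique : ∀ {k l v} → Dist k v → Dist l v → l ≤ k
  dist-unique (walk , _) (_ , minimal) = ≮⇒≥ λ k<l → minimal k<l walk

  ancestor : ∀ {k v} → Dist k v → ℕ → V G
  ancestor {v = v}     d zero    = v
  -- A default value beyond the root; the lemmas below stay at indices up to `k`.
  ancestor {zero}  {v} d (suc i) = v
  ancestor {suc k}     d (suc i) = ancestor (proj₁ (proj₂ (predecessor d))) i

  ancestor-dist : ∀ {k v} (d : Dist k v) {i} → i ≤ k → ∃[ l ] (i + l ≡ k × Dist l (ancestor d i))
  ancestor-dist {k} d {zero} _ = k , refl , d
  ancestor-dist {suc k} d {suc i} (s≤s i≤k)
    with l , eq , dₗ ← ancestor-dist (proj₁ (proj₂ (predecessor d))) i≤k = l , cong suc eq , dₗ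

  ancestor-adj : ∀ {k v} (d : Dist k v) {i} → i < k → Adj (ancestor d i) (ancestor d (suc i))
  ancestor-adj {suc k} d {zero}  _         = adj-sym (proj₂ (proj₂ (predecessor d)))
  ancestor-adj {suc k} d {suc i} (s≤s i<k) = ancestor-adj (proj₁ (proj₂ (predecessor d))) i<k

  -- The ancestors have distances `k - i` and `k - j`, which differ by at least 2, whereas equal or
  -- adjacent vertices differ by at most 1.
  ancestor-apart : ∀ {k v} (d : Dist k v) {i j} → suc i < j → j ≤ k →
    Apart G (ancestor d i) (ancestor d j)
  ancestor-apart {k} d {i} {j} i+1<j j≤k
    with l , i+l≡k , dᵢ ← ancestor-dist d {i} (≤-trans (<⇒≤ (<⇒≤ i+1<j)) j≤k)
       | m , j+m≡k , dⱼ ← ancestor-dist d j≤k =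
      (λ eq → l≰1+m (m≤n⇒m≤1+n (dist-unique dⱼ (subst (Dist l) eq dᵢ)))) ,
      (λ ij → l≰1+m (dist-step dⱼ dᵢ (adj-sym ij)))
    where
    l≰1+m : ¬ l ≤ suc m
    l≰1+m l≤1+m = <⇒≱ (+-monoˡ-< m i+1<j) (≤-trans (≤-reflexive (trans j+m≡k (sym i+l≡k)))
      (≤-trans (+-monoʳ-≤ i l≤1+m) (≤-reflexive (+-suc i m))))

  dist⇒P≤ᵢ : ∀ {k v n} → Dist k v → n ≤ suc k → P n ≤ᵢ G
  dist⇒P≤ᵢ {k} {n = n} d n≤1+k = ≤ᵢ-intro (ancestor d ∘ toℕ) adj apart
    where
    bound : ∀ (i : Fin n) → toℕ i ≤ k
    bound i = ≤-pred (≤-trans (toℕ<n i) n≤1+k)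
    adj : ∀ {i j : Fin n} → Graph.Adj (P n) i j → Adj (ancestor d (toℕ i)) (ancestor d (toℕ j))
    adj {i} {j} (inj₁ i+1≡j) = subst (Adj _ ∘ ancestor d) i+1≡j
      (ancestor-adj d (≤-trans (≤-reflexive i+1≡j) (bound j)))
    adj {i} {j} (inj₂ j+1≡i) = adj-sym (adj {j} {i} (inj₁ j+1≡i))
    apart : ∀ {i j : Fin n} → i ≢ j → ¬ Graph.Adj (P n) i j →
            Apart G (ancestor d (toℕ i)) (ancestor d (toℕ j))
    apart {i} {j} i≢j i≁j with Fin.<-cmp i j
    ... | tri< i<j _ _ = ancestor-apart d (≤∧≢⇒< i<j (i≁j ∘ inj₁)) (bound j)
    ... | tri≈ _ i≡j _ = contradiction i≡j i≢j
    ... | tri> _ _ j<i = apart-sym G (ancestor-apart d (≤∧≢⇒< j<i (i≁j ∘ inj₂)) (bound i))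

  -- The vertices before and after it on a shortest path lie at distances `k` and `k + 2`, so they
  -- are neither equal nor adjacent.
  predecessor-nonSimplicial : ∀ {k v} (d : Dist (suc (suc k)) v) →
    NonSimplicial G (proj₁ (predecessor d))
  predecessor-nonSimplicial {k} {v} d
    with dᵤ ← proj₁ (proj₂ (predecessor d)) | uv ← proj₂ (proj₂ (predecessor d))
    with w , d𝓌 , wu ← predecessor dᵤ =
    w , v , adj-sym wu , uv , (λ { refl → <⇒≱ (n<1+n _) (≤-trans (dist-unique d𝓌 d) (n≤1+n k)) }) ,
    λ wv → <⇒≱ (n<1+n _) (dist-step d𝓌 d wv)

-- Balls of non-simplicial vertices around a root

module Layers (G : Graph) (r : V G) where
  open Graph G using (Adj; adj?)
  open Distance G r

  heir? : ∀ u → Unary.Decidable (λ v → Adj u v × 2≤α∘N G v)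
  heir? u v = adj? u v ×-dec 2≤α∘N? G v

  heirs : V G → Subset (Graph.order G)
  heirs u = ⟪ heir? u ⟫

  -- Each `u` is kept along with its heirs, so the balls grow with the radius. Repetitions are
  -- harmless, for only an upper bound on the length is wanted; fewer than `M` heirs leave room for
  -- `u` within the factor `M`.
  ball : ℕ → List (V G)
  ball zero    = r ∷ []
  ball (suc k) = concatMap (λ u → u ∷ List.tabulate (element (heirs u))) (ball k)

  ball-≤ : ∀ {M} → (∀ u → ∣ heirs u ∣ < M) → ∀ k → length (ball k) ≤ M ^ k
  ball-≤ heirs<M zero    = ≤-refl
  ball-≤ {M} heirs<M (suc k) = ≤-trans
    (length-concatMap-≤ (λ u → ≤-trans (s≤s (≤-reflexive (length-tabulate _))) (heirs<M u)) (ball k))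
    (*-monoʳ-≤ M (ball-≤ heirs<M k))

  ball-step : ∀ k {u v} → u ∈ ball k → v ∈ u ∷ List.tabulate (element (heirs u)) → v ∈ ball (suc k)
  ball-step k u∈ v∈ = ∈-concatMap⁺ _ (lose u∈ v∈)

  ball-mono : ∀ {v} j k → v ∈ ball k → v ∈ ball (j + k)
  ball-mono zero    k v∈ = v∈
  ball-mono (suc j) k v∈ = ball-step (j + k) (ball-mono j k v∈) (here refl)

  -- The induction stays among counted vertices: the predecessor is an inner vertex of a shortest
  -- path, or it is the root.
  dist⇒∈ball : 2≤α∘N G r → ∀ {k v} → Dist k v → 2≤α∘N G v → v ∈ ball k
  dist⇒∈ball ns-r {zero}  (refl , _) _    = here refl
  dist⇒∈ball ns-r {suc k} {v} d      ns-v = ball-step k (dist⇒∈ball ns-r dᵤ (ns-u k d)) (there v∈)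
    where
    u  = proj₁ (predecessor d)
    dᵤ = proj₁ (proj₂ (predecessor d))
    ns-u : ∀ k (d : Dist (suc k) v) → 2≤α∘N G (proj₁ (predecessor d))
    ns-u zero    ((_ , refl , _) , _) = ns-r
    ns-u (suc _) d = nonSimplicial⇒2≤α∘N G (predecessor-nonSimplicial d)
    v∈ : v ∈ List.tabulate (element (heirs u))
    v∈ with i , eq ← element⁻¹ (∈⟪⟫⁺ (heir? u) (proj₂ (proj₂ (predecessor d)) , ns-v)) =
      subst (_∈ _) eq (∈-tabulate⁺ i)

module _ {G : Graph} {n : ℕ} where
  open Forcing G n using (Found; hub-found)
  open Bounds n using (hubBound)

  -- Without `P n` all distances are below `n`, and by `hub-found` every vertex has fewer than
  -- `hubBound` heirs; so the ball of radius `n` is small and contains every counted vertex.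
  ¬found⇒bounded : Connected G → ¬ Found → #[α∘N≥2] G ≤ hubBound ^ n
  -- A count above the bound is positive and so supplies a counted vertex as the root.
  ¬found⇒bounded connected ¬found = ≮⇒≥ λ bound<# →
    let r = fromℕ< bound<# in <⇒≱ bound<# (bounded r)
    where
    S = ⟪ 2≤α∘N? G ⟫
    bounded : Fin ∣ S ∣ → ∣ S ∣ ≤ hubBound ^ n
    bounded i₀ = ≤-trans (injective⇒≤length (element-injective S) covered) (ball-≤ heirs< n)
      where
      r = element S i₀
      open Distance G r
      open Layers G r
      heirs< : ∀ u → ∣ heirs u ∣ < hubBound
      heirs< u = ≰⇒> λ hub → ¬found (hub-found {u} {λ i → element (heirs u) (inject≤ i hub)}
        (Fin.inject≤-injective hub hub _ _ ∘ element-injective (heirs u))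
        (λ i → proj₁ (element-⟪⟫ (heir? u) (inject≤ i hub)))
        (λ i → 2≤α∘N⇒nonSimplicial G (proj₂ (element-⟪⟫ (heir? u) (inject≤ i hub)))))
      covered : ∀ i → element S i ∈ ball n
      covered i with k , d ← dist (connected r (element S i)) with n ≤? suc k
      ... | yes n≤1+k = contradiction (_ , there (here refl) , dist⇒P≤ᵢ d n≤1+k) ¬found
      -- The distance `k` is below `n`, so the ball of radius `k` is enlarged to radius `n`.
      ... | no n≰1+k = subst (λ m → element S i ∈ ball m) (m∸n+n≡m (<⇒≤ (<⇒≤ (≰⇒> n≰1+k))))
              (ball-mono (n ∸ k) k (dist⇒∈ball (element-⟪⟫ (2≤α∘N? G) i₀) d (element-⟪⟫ (2≤α∘N? G) i)))

-- The seven graphs are unbounded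

nonSimplicial-count : ∀ G {k} {f : Fin k → V G} → Injective _≡_ _≡_ f →
  (∀ i → NonSimplicial G (f i)) → k ≤ #[α∘N≥2] G
nonSimplicial-count G f-inj ns =
  injective⇒≤∣∣ _ f-inj λ i → ∈⟪⟫⁺ (2≤α∘N? G) (nonSimplicial⇒2≤α∘N G (ns i))

hub⇒connected : ∀ G h → (∀ v → Star (Graph.Adj G) v h) → Connected G
hub⇒connected G h toHub u v = toHub u ◅◅ Star.reverse (Graph.adj-sym G) (toHub v)

module Relabelled (H : Graph) {A : Set} (A-finite : Fin (Graph.order H) ↔ A) (R : Rel A 0ℓ)
                  (adj≡R : Graph.Adj H ≡ (R on Inverse.to A-finite)) where
  open Inverse A-finite using (to; from; strictlyInverseˡ; strictlyInverseʳ)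

  from-injective : Injective _≡_ _≡_ from
  from-injective {x} {y} eq = trans (sym (strictlyInverseˡ x)) (trans (cong to eq) (strictlyInverseˡ y))

  from-adj⁺ : ∀ {x y} → R x y → Graph.Adj H (from x) (from y)
  from-adj⁺ {x} {y} xy = subst (λ S → S (from x) (from y)) (sym adj≡R)
    (subst₂ R (sym (strictlyInverseˡ x)) (sym (strictlyInverseˡ y)) xy)

  from-adj⁻ : ∀ {x y} → Graph.Adj H (from x) (from y) → R x y
  from-adj⁻ {x} {y} xy = subst₂ R (strictlyInverseˡ x) (strictlyInverseˡ y)
    (subst (λ S → S (from x) (from y)) adj≡R xy)

  connected : ∀ h → (∀ x → Star R x h) → Connected H
  connected h toHub = hub⇒connected H (from h) λ v →
    subst (λ u → Star (Graph.Adj H) u (from h)) (strictlyInverseʳ v) (Star.gmap from from-adj⁺ (toHub (to v)))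

  nonSimplicial : ∀ {x a b} → R x a → R x b → a ≢ b → ¬ R a b → NonSimplicial H (from x)
  nonSimplicial xa xb a≢b a≁b =
    _ , _ , from-adj⁺ xa , from-adj⁺ xb , a≢b ∘ from-injective , a≁b ∘ from-adj⁻

Large : ℕ → Pred Graph 0ℓ
Large k G = Connected G × k ≤ #[α∘N≥2] G

-- Any vertex other than `i` would do: it is a clique neighbour of `i` that misses the pendant or
-- partner of `i`.
other : ∀ {m} → Fin (2 + m) → Fin (2 + m)
other zero    = suc zero
other (suc _) = zero

other≢ : ∀ {m} (i : Fin (2 + m)) → other i ≢ i
other≢ zero    ()
other≢ (suc _) ()

K*-large : ∀ m → Large (2 + m) (K* (2 + m))
K*-large m = connected (inj₁ zero) toHub ,
  nonSimplicial-count (K* (2 + m)) (inj₁-injective ∘ from-injective) λ i →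
    nonSimplicial {inj₁ i} {inj₁ (other i)} {inj₂ i} (other≢ i ∘ sym) refl (λ ()) (other≢ i)
  where
  open Relabelled (K* (2 + m)) Fin.+↔⊎ (PendantAdj (K (2 + m)) id) refl
  toHub : ∀ x → Star (PendantAdj (K (2 + m)) id) x (inj₁ zero)
  toHub (inj₁ zero)    = ε
  toHub (inj₁ (suc i)) = (λ ()) ◅ ε
  toHub (inj₂ zero)    = refl ◅ ε
  toHub (inj₂ (suc j)) = _◅_ {j = inj₁ (suc j)} refl ((λ ()) ◅ ε)

P-large : ∀ m → Large m (P (2 + m))
P-large m = hub⇒connected (P (2 + m)) zero toHub ,
  nonSimplicial-count (P (2 + m)) {f = suc ∘ inject₁} (Fin.inject₁-injective ∘ Fin.suc-injective) λ i →
    inject₁ (inject₁ i) , suc (suc i) ,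
    inj₂ (cong suc (Fin.toℕ-inject₁ (inject₁ i))) , inj₁ (cong (2 +_) (Fin.toℕ-inject₁ i)) ,
    (λ eq → <⇒≢ (m≤n⇒m≤1+n (n<1+n _)) (trans (sym (gap i)) (cong toℕ eq))) ,
    λ { (inj₁ eq) → <⇒≢ (n<1+n _) (trans (cong suc (sym (gap i))) eq)
      ; (inj₂ eq) → <⇒≢ (m≤n⇒m≤1+n (m≤n⇒m≤1+n (n<1+n _))) (sym (trans eq (gap i))) }
  where
  gap : ∀ (i : Fin m) → toℕ (inject₁ (inject₁ i)) ≡ toℕ i
  gap i = trans (Fin.toℕ-inject₁ (inject₁ i)) (Fin.toℕ-inject₁ i)
  toHub : ∀ v → Star (Graph.Adj (P (2 + m))) v zero
  toHub = <-weakInduction (λ v → Star (Graph.Adj (P (2 + m))) v zero) ε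
    λ i walk → inj₂ (cong suc (Fin.toℕ-inject₁ i)) ◅ walk

K₁*-large : ∀ n → Large n (K₁* n)
K₁*-large n = connected (inj₁ zero) toHub ,
  nonSimplicial-count (K₁* n) (Fin.suc-injective ∘ inj₁-injective ∘ from-injective) λ i →
    nonSimplicial {inj₁ (suc i)} {inj₁ zero} {inj₂ i} tt refl (λ ()) (λ ())
  where
  open Relabelled (K₁* n) Fin.+↔⊎ (PendantAdj K[ 1 , n ] (1 ↑ʳ_)) refl
  toHub : ∀ x → Star (PendantAdj K[ 1 , n ] (1 ↑ʳ_)) x (inj₁ zero)
  toHub (inj₁ zero)    = ε
  toHub (inj₁ (suc i)) = tt ◅ ε
  toHub (inj₂ j)       = _◅_ {j = inj₁ (suc j)} refl (tt ◅ ε)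

-- The vertices of `E 2` are non-adjacent neighbours of each vertex of `H`. They are connected only
-- through `H`, whence the vertex `h`.
E₂+-large : ∀ H → V H → Large (Graph.order H) (E 2 +ᴳ H)
E₂+-large H h = connected (inj₁ zero) toHub ,
  nonSimplicial-count (E 2 +ᴳ H) (inj₂-injective ∘ from-injective) λ i →
    nonSimplicial {inj₂ i} {inj₁ zero} {inj₁ (suc zero)} tt tt (λ ()) id
  where
  open Relabelled (E 2 +ᴳ H) Fin.+↔⊎ (JoinAdj (E 2) H) refl
  toHub : ∀ x → Star (JoinAdj (E 2) H) x (inj₁ zero)
  toHub (inj₁ zero)       = ε
  toHub (inj₁ (suc zero)) = _◅_ {j = inj₂ h} tt (tt ◅ ε)
  toHub (inj₂ v)          = tt ◅ ε

K₁+-large : ∀ H {k} {f : Fin k → V H} → Injective _≡_ _≡_ f → (∀ i → NonSimplicial H (f i)) →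
  Large k (K 1 +ᴳ H)
K₁+-large H {f = f} f-inj ns = connected (inj₁ zero) toHub ,
  nonSimplicial-count (K 1 +ᴳ H) (f-inj ∘ inj₂-injective ∘ from-injective) λ i →
    let a , b , fa , fb , a≢b , a≁b = ns i in
    nonSimplicial {inj₂ (f i)} {inj₂ a} {inj₂ b} fa fb (a≢b ∘ inj₂-injective) a≁b
  where
  open Relabelled (K 1 +ᴳ H) Fin.+↔⊎ (JoinAdj (K 1) H) refl
  toHub : ∀ x → Star (JoinAdj (K 1) H) x (inj₁ zero)
  toHub (inj₁ zero) = ε
  toHub (inj₂ v)    = tt ◅ ε

K₁P₃-large : ∀ n → Large n (K 1 +ᴳ n · P 3)
K₁P₃-large n = K₁+-large (n · P 3) (cong proj₁ ∘ from-injective) λ i →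
  nonSimplicial {i , suc zero} {i , zero} {i , suc (suc zero)} (refl , inj₂ refl) (refl , inj₁ refl)
    (λ ()) λ { (_ , inj₁ ()) ; (_ , inj₂ ()) }
  where
  open Relabelled (n · P 3) (Fin.*↔× {n} {3}) (λ (i , u) (j , v) → i ≡ j × Graph.Adj (P 3) u v) refl

CK-large : ∀ m → Large (2 + m) (CK (2 + m))
CK-large m = connected (inj₁ zero) toHub ,
  nonSimplicial-count (CK (2 + m)) (inj₁-injective ∘ from-injective) λ i →
    nonSimplicial {inj₁ i} {inj₁ (other i)} {inj₂ i} (other≢ i ∘ sym) refl (λ ()) (other≢ i)
  where
  open Relabelled (CK (2 + m)) Fin.+↔⊎ (CKAdj (2 + m)) refl
  toHub : ∀ x → Star (CKAdj (2 + m)) x (inj₁ zero)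
  toHub (inj₁ zero)    = ε
  toHub (inj₁ (suc i)) = (λ ()) ◅ ε
  toHub (inj₂ zero)    = refl ◅ ε
  toHub (inj₂ (suc j)) = _◅_ {j = inj₁ (suc j)} refl ((λ ()) ◅ ε)

large-weaken : ∀ G {k} → Large (2 + k) G → Large k G
large-weaken G {k} (connected , 2+k≤) = connected , ≤-trans (m≤n+m k 2) 2+k≤

-- The path fixes the offset 2: its two ends are simplicial.
unavoidable-large : ∀ k {H} → unavoidable (2 + k) H → Large k H
unavoidable-large k (here refl)                 = large-weaken (K* (2 + k)) (K*-large k)
unavoidable-large k (there (here refl))         = P-large k
unavoidable-large k (there (there (here refl))) = large-weaken (K₁* (2 + k)) (K₁*-large (2 + k))
unavoidable-large k (there (there (there (here refl)))) =
  large-weaken K[ 2 , 2 + k ] (E₂+-large (E (2 + k)) zero)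
unavoidable-large k (there (there (there (there (here refl))))) =
  large-weaken (E 2 +ᴳ K (2 + k)) (E₂+-large (K (2 + k)) zero)
unavoidable-large k (there (there (there (there (there (here refl)))))) =
  large-weaken (K 1 +ᴳ (2 + k) · P 3) (K₁P₃-large (2 + k))
unavoidable-large k (there (there (there (there (there (there (here refl))))))) =
  large-weaken (CK (2 + k)) (CK-large k)

-- The equivalence

≤ᵢ-trans : ∀ {G₁ G₂ G₃} → G₁ ≤ᵢ G₂ → G₂ ≤ᵢ G₃ → G₁ ≤ᵢ G₃
≤ᵢ-trans g h = ≤ᵢ-intro (embed h ∘ embed g) (≤ᵢ⇒adj h ∘ ≤ᵢ⇒adj g)
  λ u≢v u≁v → let a≢b , a≁b = ≤ᵢ⇒apart g u≢v u≁v in ≤ᵢ⇒apart h a≢b a≁b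

theorem1p4 : ∀ {ℓ} → ExcludedMiddle (lsuc 0ℓ ⊔ ℓ) → (ℋ : Pred Graph ℓ) →
    (∃[ C ] (∀ G → Connected G → Free ℋ G → #[α∘N≥2] G ≤ C))
    ⇔ (∃[ n ] (1 ≤ n × ℋ ≼ unavoidable n))
theorem1p4 em ℋ = mk⇔ bounded⇒≼ ≼⇒bounded
  where
  bounded⇒≼ : ∃[ C ] (∀ G → Connected G → Free ℋ G → #[α∘N≥2] G ≤ C) → ∃[ n ] (1 ≤ n × ℋ ≼ unavoidable n)
  -- `3 + C` is `2 + (1 + C)`, where `unavoidable-large` gives more than `C` counted vertices.
  bounded⇒≼ (C , bound) = 3 + C , s≤s z≤n , induced
    where
    induced : ℋ ≼ unavoidable (3 + C)
    -- `ℋ` is arbitrary, so excluded middle decides whether `H` contains a member of it; if not, `H`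
    -- itself violates the bound.
    induced H H∈ with em {∃[ H₁ ] (ℋ H₁ × H₁ ≤ᵢ H)}
    ... | yes found = found
    ... | no free with connected , C<# ← unavoidable-large (suc C) H∈ =
      contradiction (bound H connected free) (<⇒≱ C<#)
  ≼⇒bounded : ∃[ n ] (1 ≤ n × ℋ ≼ unavoidable n) → ∃[ C ] (∀ G → Connected G → Free ℋ G → #[α∘N≥2] G ≤ C)
  ≼⇒bounded (n , _ , ℋ≼) = Bounds.hubBound n ^ n , λ G connected free →
    ¬found⇒bounded connected λ (H , H∈ , H≤G) →
      let H₁ , H₁∈ℋ , H₁≤H = ℋ≼ H H∈ in free (H₁ , H₁∈ℋ , ≤ᵢ-trans H₁≤H H≤G)
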